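{- Let $p\ge 3$ be a prime and let $a(n)=a_{1+x,p}(n)$ be the number of accessible $n$-blocks for the polynomial $1+x$ modulo $p$. Then, as formal power series in $z$, $$\sum_{n=0}^{\infty}a(n)z^n=\frac{1}{(1-z)^3}\bigg(1+(p-3)z+(p^2-3p+3)z^2+z^2\frac{(p-1)^2}{2}\sum_{i\ge 0}\Big(p\,z^{p^i}-2(p-1)z^{2p^i}+(p-2)z^{3p^i}\Big)\bigg).$$
   Context: For a prime $p$ and a polynomial $f(x)$ with integer coefficients, "row $i$" is the string of coefficients of $f(x)^i$ reduced modulo $p$, ordered by increasing powers of $x$ (from $x^0$ up to $x^{\deg f^i}$). An $m$-block is a string of $m$ residues modulo $p$; it is accessible if it occurs as a substring of consecutive entries of row $i$ for some $i\ge0$. $a_{f,p}(m)$ is the number of accessible $m$-blocks, with the convention $a_{f,p}(0)=1$. -}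

module Defs where

open import Data.Nat as ℕ using (ℕ; zero; suc; _<_; _≟_; _∸_)
import Data.Nat.DivMod as ℕD
open import Data.Integer as ℤ using (ℤ; +_; _+_; _*_; _-_; -_)
open import Data.Integer.DivMod using (_%ℕ_)
open import Data.List using (List; []; _∷_; _++_; length; map)
open import Data.List.Relation.Unary.All using (All)
open import Data.List.Relation.Unary.Unique.Propositional using (Unique)
open import Data.List.Membership.Propositional using (_∈_)
open import Data.Product using (Σ; ∃; _×_; _,_)
open import Relation.Binary.PropositionalEquality using (_≡_)
open import Relation.Nullary.Decidable using (does)
open import Data.Bool using (if_then_else_)

-- Integer polynomials as coefficient lists (increasing powers of x).

Poly : Set
Poly = List ℤ

polyAdd : Poly → Poly → Poly
polyAdd [] q = q
polyAdd p [] = p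
polyAdd (a ∷ p) (b ∷ q) = (a + b) ∷ polyAdd p q

polyMul : Poly → Poly → Poly
polyMul [] q = []
polyMul (a ∷ p) q = polyAdd (map (a *_) q) (+ 0 ∷ polyMul p q)

polyPow : Poly → ℕ → Poly
polyPow f zero = + 1 ∷ []
polyPow f (suc i) = polyMul f (polyPow f i)

-- row i : coefficients of f^i reduced mod p (as residues 0..p-1),
-- from x^0 up to x^(deg f^i).
row : (p : ℕ) .{{_ : ℕ.NonZero p}} → Poly → ℕ → List ℕ
row p f i = map (λ c → c %ℕ p) (polyPow f i)

Substring : List ℕ → List ℕ → Set
Substring b r = Σ (List ℕ) λ u → Σ (List ℕ) λ v → u ++ b ++ v ≡ r

IsBlock : ℕ → ℕ → List ℕ → Set
IsBlock p m b = (length b ≡ m) × All (_< p) b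

Accessible : (p : ℕ) .{{_ : ℕ.NonZero p}} → Poly → ℕ → List ℕ → Set
Accessible p f m b = IsBlock p m b × ∃ λ i → Substring b (row p f i)

NumAccessible : (p : ℕ) .{{_ : ℕ.NonZero p}} → Poly → ℕ → ℕ → Set
NumAccessible p f m N =
  Σ (List (List ℕ)) λ L →
    Unique L × (length L ≡ N) ×
    ((b : List ℕ) → (b ∈ L → Accessible p f m b) × (Accessible p f m b → b ∈ L))

onePlusX : Poly
onePlusX = + 1 ∷ + 1 ∷ []

FPS : Set
FPS = ℕ → ℤ

sumBelow : (ℕ → ℤ) → ℕ → ℤ
sumBelow f zero = + 0
sumBelow f (suc n) = sumBelow f n + f n

_⊕_ : FPS → FPS → FPS
(a ⊕ b) n = a n + b n

_⊗_ : FPS → FPS → FPS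
(a ⊗ b) n = sumBelow (λ k → a k * b (n ∸ k)) (suc n)

infixl 6 _⊕_
infixl 7 _⊗_

const : ℤ → FPS
const c n = c ·· n
  where
  _··_ : ℤ → ℕ → ℤ
  c ·· zero = c
  c ·· suc _ = + 0

mono : ℤ → ℕ → FPS
mono c k n = if does (n ≟ k) then c else + 0

geom : FPS
geom n = + 1

-- Σ_{i ≥ 0} ( p z^{p^i} - 2(p-1) z^{2p^i} + (p-2) z^{3p^i} ),
-- a locally finite formal sum: since p ≥ 2, p^i > n for i > n, so the
-- coefficient of z^n only involves the terms with i ≤ n.
innerSum : ℕ → FPS
innerSum p n = sumBelow term (suc n)
  where
  term : ℕ → ℤ
  term i = mono (+ p) (p ℕ.^ i) n
         + mono (- (+ 2 * (+ p - + 1))) (2 ℕ.* p ℕ.^ i) n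
         + mono (+ p - + 2) (3 ℕ.* p ℕ.^ i) n

numerator : ℕ → FPS
numerator p =
  mono (+ 1) 0
  ⊕ mono (+ p - + 3) 1
  ⊕ mono (+ p * + p - + 3 * + p + + 3) 2
  ⊕ mono (+ (((p ∸ 1) ℕ.* (p ∸ 1)) ℕ./ 2)) 2 ⊗ innerSum p

rhs : ℕ → FPS
rhs p = geom ⊗ geom ⊗ geom ⊗ numerator p

{-# OPTIONS --safe #-}

-- By Lucas' theorem, row k + i p (with k < p) is row i with every entry c replaced by c C(k,0), …, c C(k,p-1).
-- A block of length n whose position is k + 1 + s modulo p (with s < p) shows ⌊(n+k+s)/p⌋ consecutive entries
-- of row i, and determines them. For n ≥ 3 it also determines k and s, because the absorption identity
-- (j+1) C(i+1,j+1) = (i+1) C(i,j) recovers row and column modulo p, unless the block is one of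
-- 0…0, a0…0, 0…0b, or a,-a,a,… . These 1 + 3(p-1) blocks arise from p² + 3p(p-1) triples (k, s, block), so
--   a(n) = Σ_{k,s<p} a(⌊(n+k+s)/p⌋) - (p² + 3p(p-1)) + 1 + 3(p-1)   for n ≥ 3.
-- Its second difference is Δ²a(n) = Δ²a(⌊n/p⌋). The right-hand side of the theorem satisfies the same, as
-- the partial sums of the inner sum only depend on the leading base-p digit, and has the initial values 1, p, p².

module Submission where

open import Defs
open import Data.Nat using (ℕ; _≤_; NonZero)
open import Data.Nat.Primality using (Prime)
open import Data.Integer using (+_)
open import Data.Product using (Σ; _×_)
open import Relation.Binary.PropositionalEquality using (_≡_)

open import Data.Nat as ℕ using (zero; suc; _<_; z≤n; s≤s; _∸_; _/_; _%_; _^_; pred)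
open import Data.Nat.Properties as ℕₚ using ()
import Data.Nat.DivMod as DM
open import Data.Nat.Divisibility as Div using (_∣_; ∣-refl)
open import Data.Nat.Induction using (<-rec)
open import Data.Nat.Primality using (euclidsLemma; prime⇒irreducible; prime⇒nonTrivial)
open import Data.Nat.Coprimality using (prime⇒coprime; coprime-Bézout)
open import Data.Nat.GCD using (module Bézout)
open import Data.Nat.Combinatorics using (_C_; nCk+nC[k+1]≡[n+1]C[k+1]; nCn≡1; nC1≡n; k>n⇒nCk≡0)
import Data.Nat.Tactic.RingSolver as ℕ-Ring
open import Data.Integer as ℤ using (ℤ)
import Data.Integer.Properties as ℤₚ
open import Data.Integer.DivMod using (_%ℕ_)
import Data.Integer.Tactic.RingSolver as ℤ-Ring
open import Data.List using (List; []; _∷_; _++_; length; map; filter; upTo; applyUpTo; cartesianProduct)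
open import Data.List.Properties
  using (length-++; length-map; length-upTo; length-applyUpTo; map-applyUpTo; map-id; map-cong; ∷-injective; ≡-dec)
open import Data.List.Relation.Unary.All as All using ([]; _∷_)
import Data.List.Relation.Unary.All.Properties as Allₚ
open import Data.List.Relation.Unary.Any using (here; there)
open import Data.List.Relation.Unary.AllPairs using ([]; _∷_)
open import Data.List.Relation.Unary.Unique.Propositional using (Unique)
import Data.List.Relation.Unary.Unique.Propositional.Properties as Uniqueₚ
open import Data.List.Membership.Propositional using (_∈_)
import Data.List.Membership.Propositional.Properties as ∈ₚ
open import Data.List.Membership.Propositional.Properties.WithK using (unique∧set⇒bag)
import Data.List.Membership.DecPropositional as DecMembership
open import Data.List.Relation.Binary.BagAndSetEquality using (∼bag⇒↭)
open import Data.List.Relation.Binary.Permutation.Propositional.Properties using (↭-length)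
open import Data.Product using (∃; ∃₂; _,_; proj₁; proj₂)
open import Data.Product.Properties using () renaming (≡-dec to ×-≡-dec)
open import Data.Sum as Sum using (_⊎_; inj₁; inj₂; [_,_]′)
open import Data.Empty using (⊥)
open import Function using (_∘_)
open import Function.Bundles using (mk⇔)
open import Relation.Nullary using (¬_; Dec; yes; no; contradiction)
open import Relation.Nullary.Decidable using (_×-dec_; ¬?; map′; dec-true; dec-false; decidable-stable)
open import Relation.Binary.Definitions using (DecidableEquality)
open import Relation.Binary.PropositionalEquality
  using (_≢_; refl; sym; trans; cong; cong₂; subst; subst₂; module ≡-Reasoning)

-- Finite cardinalities

module _ where
  record Card {A : Set} (P : A → Set) (z : ℤ) : Set where
    constructor card
    field
      elements : List A
      unique   : Unique elements
      count    : + length elements ≡ z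
      sound    : ∀ {x} → x ∈ elements → P x
      complete : ∀ {x} → P x → x ∈ elements

  open Card

  length-cartesianProduct : {A B : Set} (xs : List A) (ys : List B) →
    length (cartesianProduct xs ys) ≡ length xs ℕ.* length ys
  length-cartesianProduct [] ys = refl
  length-cartesianProduct (x ∷ xs) ys = trans (length-++ (map (x ,_) ys))
    (cong₂ ℕ._+_ (length-map (x ,_) ys) (length-cartesianProduct xs ys))

  private variable
    A B : Set
    P Q : A → Set
    z w : ℤ

  map-unique : (f : A → B) (xs : List A) →
    (∀ {x y} → x ∈ xs → y ∈ xs → f x ≡ f y → x ≡ y) → Unique xs → Unique (map f xs)
  map-unique f [] inj [] = []
  map-unique f (x ∷ xs) inj (x∉ ∷ u) =
    Allₚ.map⁺ (All.tabulate λ y∈ eq → All.lookup x∉ y∈ (inj (here refl) (there y∈) eq))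
    ∷ map-unique f xs (λ x∈ y∈ → inj (there x∈) (there y∈)) u

  card-resp : (∀ {x} → P x → Q x) → (∀ {x} → Q x → P x) → Card P z → Card Q z
  card-resp to from (card xs u c s k) = card xs u c (to ∘ s) (k ∘ from)

  card-≡ : z ≡ w → Card P z → Card P w
  card-≡ refl c = c

  card-⊎ : Card P z → Card Q w → (∀ {x} → P x → Q x → ⊥) → Card (λ x → P x ⊎ Q x) (z ℤ.+ w)
  card-⊎ (card xs u c s k) (card ys u′ c′ s′ k′) disjoint = card (xs ++ ys)
    (Uniqueₚ.++⁺ u u′ (λ (x∈ , y∈) → disjoint (s x∈) (s′ y∈)))
    (trans (cong +_ (length-++ xs)) (trans (ℤₚ.pos-+ (length xs) (length ys)) (cong₂ ℤ._+_ c c′)))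
    ([ inj₁ ∘ s , inj₂ ∘ s′ ]′ ∘ ∈ₚ.∈-++⁻ xs)
    [ ∈ₚ.∈-++⁺ˡ ∘ k , ∈ₚ.∈-++⁺ʳ xs ∘ k′ ]′

  card-image : (f : A → B) → (∀ {x y} → P x → P y → f x ≡ f y → x ≡ y) →
    Card P z → Card (λ y → ∃ λ x → P x × y ≡ f x) z
  card-image f inj (card xs u c s k) = card (map f xs)
    (map-unique f xs (λ x∈ y∈ → inj (s x∈) (s y∈)) u)
    (trans (cong +_ (length-map f xs)) c)
    (λ y∈ → let (x , x∈ , eq) = ∈ₚ.∈-map⁻ f y∈ in x , s x∈ , eq)
    (λ { (x , px , refl) → ∈ₚ.∈-map⁺ f (k px) })

  card-singleton : (a : A) → Card (_≡ a) (+ 1)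
  card-singleton a = card (a ∷ []) ([] ∷ []) refl (λ { (here eq) → eq }) here

  card-< : ∀ K → Card (_< K) (+ K)
  card-< K = card (upTo K) (Uniqueₚ.upTo⁺ K) (cong +_ (length-upTo K)) ∈ₚ.∈-upTo⁻ ∈ₚ.∈-upTo⁺

  card-× : {P : A → Set} {Q : B → Set} → Card P z → Card Q w →
    Card (λ (x , y) → P x × Q y) (z ℤ.* w)
  card-× (card xs u c s k) (card ys u′ c′ s′ k′) = card (cartesianProduct xs ys)
    (Uniqueₚ.cartesianProduct⁺ u u′)
    (trans (cong +_ (length-cartesianProduct xs ys))
      (trans (ℤₚ.pos-* (length xs) (length ys)) (cong₂ ℤ._*_ c c′)))
    (λ xy∈ → let (x∈ , y∈) = ∈ₚ.∈-cartesianProduct⁻ xs ys xy∈ in s x∈ , s′ y∈)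
    (λ (px , qy) → ∈ₚ.∈-cartesianProduct⁺ (k px) (k′ qy))

  Indexed : ℕ → (ℕ → A → Set) → ℕ × A → Set
  Indexed K P (k , x) = k < K × P k x

  card-Σ : {P : ℕ → A → Set} (h : ℕ → ℤ) (K : ℕ) → (∀ k → k < K → Card (P k) (h k)) →
    Card (Indexed K P) (sumBelow h K)
  card-Σ h zero c = card [] [] refl (λ ()) (λ ())
  card-Σ {A = A} {P = P} h (suc K) c = card-resp to from
    (card-⊎ (card-Σ h K (λ k k<K → c k (ℕₚ.m<n⇒m<1+n k<K)))
            (card-image (K ,_) (λ { _ _ refl → refl }) (c K ℕₚ.≤-refl))
            λ { (k<k , _) (_ , _ , refl) → ℕₚ.<-irrefl refl k<k })
    where
    Last : ℕ × A → Set
    Last y = ∃ λ x → P K x × y ≡ (K , x)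
    to : ∀ {y} → Indexed K P y ⊎ Last y → Indexed (suc K) P y
    to (inj₁ (k<K , px)) = ℕₚ.m<n⇒m<1+n k<K , px
    to (inj₂ (_ , px , refl)) = ℕₚ.≤-refl , px
    from : ∀ {y} → Indexed (suc K) P y → Indexed K P y ⊎ Last y
    from (k<1+K , px) with ℕₚ.m≤n⇒m<n∨m≡n (ℕₚ.≤-pred k<1+K)
    ... | inj₁ k<K = inj₁ (k<K , px)
    ... | inj₂ refl = inj₂ (_ , px , refl)

  card-∖ : DecidableEquality A → {P Q : A → Set} → Card P z → Card Q w → (∀ {x} → Q x → P x) →
    Card (λ x → P x × ¬ Q x) (z ℤ.- w)
  card-∖ {z = z} {w = w} _≟_ (card xs u c s k) (card ys u′ c′ s′ k′) Q⊆P = card rest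
    rest-unique
    (trans (sym (ℤₚ.+-identityʳ _)) (trans (cong (ℤ._+_ (+ length rest)) (sym (ℤₚ.+-inverseʳ w)))
      (trans (sym (ℤₚ.+-assoc (+ length rest) w (ℤ.- w))) (cong (ℤ._- w) total))))
    (λ x∈ → let (x∈xs , x∉ys) = ∈ₚ.∈-filter⁻ ∉ys? {xs = xs} x∈ in s x∈xs , x∉ys ∘ k′)
    (λ (px , ¬qx) → ∈ₚ.∈-filter⁺ ∉ys? (k px) (¬qx ∘ s′))
    where
    open DecMembership _≟_ using (_∈?_)
    ∉ys? = λ x → ¬? (x ∈? ys)
    rest = filter ∉ys? xs
    rest-unique = Uniqueₚ.filter⁺ ∉ys? u
    split : ∀ {x} → x ∈ xs → x ∈ rest ++ ys
    split {x} x∈ with x ∈? ys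
    ... | yes x∈ys = ∈ₚ.∈-++⁺ʳ rest x∈ys
    ... | no x∉ys = ∈ₚ.∈-++⁺ˡ (∈ₚ.∈-filter⁺ ∉ys? x∈ x∉ys)
    join : ∀ {x} → x ∈ rest ++ ys → x ∈ xs
    join x∈ with ∈ₚ.∈-++⁻ rest x∈
    ... | inj₁ x∈rest = proj₁ (∈ₚ.∈-filter⁻ ∉ys? {xs = xs} x∈rest)
    ... | inj₂ x∈ys = k (Q⊆P (s′ x∈ys))
    total : + length rest ℤ.+ w ≡ z
    total = trans (cong (ℤ._+_ (+ length rest)) (sym c′)) (trans (sym (ℤₚ.pos-+ (length rest) (length ys)))
      (trans (cong +_ (trans (sym (length-++ rest))
        (↭-length (∼bag⇒↭ (unique∧set⇒bag
          (Uniqueₚ.++⁺ rest-unique u′ (λ (x∈ , x∈ys) → proj₂ (∈ₚ.∈-filter⁻ ∉ys? {xs = xs} x∈) x∈ys))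
          u (mk⇔ join split)))))) c))

  card⇒decidable : {A : Set} {P : A → Set} {z : ℤ} → DecidableEquality A → Card P z → ∀ x → Dec (P x)
  card⇒decidable _≟_ c x = map′ (Card.sound c) (Card.complete c) (x ∈? Card.elements c)
    where open DecMembership _≟_ using (_∈?_)

-- The power series

module _ where
  open import Data.Nat using (_*_)

  n<m^n : ∀ {m} → 1 < m → ∀ n → n < m ^ n
  n<m^n 1<m zero = s≤s z≤n
  n<m^n {suc (suc m)} 1<m (suc n) = ℕₚ.+-mono-≤ (ℕₚ.≤-trans (s≤s z≤n) (n<m^n 1<m n))
    (ℕₚ.≤-trans (n<m^n 1<m n) (ℕₚ.m≤n*m (suc (suc m) ^ n) (suc m)))
  n<m^n {suc zero} (s≤s ())

module _ where
  open import Data.Integer using (_+_; _*_; _-_; -_)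

  sum-cong : ∀ {f g : ℕ → ℤ} n → (∀ k → k < n → f k ≡ g k) → sumBelow f n ≡ sumBelow g n
  sum-cong zero eq = refl
  sum-cong (suc n) eq = cong₂ _+_ (sum-cong n (λ k k<n → eq k (ℕₚ.m<n⇒m<1+n k<n))) (eq n ℕₚ.≤-refl)

  sum-head : ∀ (f : ℕ → ℤ) n → sumBelow f (suc n) ≡ f 0 + sumBelow (f ∘ suc) n
  sum-head f zero = ℤₚ.+-comm (+ 0) (f 0)
  sum-head f (suc n) = trans (cong (_+ f (suc n)) (sum-head f n)) (ℤₚ.+-assoc (f 0) _ _)

  sum-0 : ∀ n → sumBelow (λ _ → + 0) n ≡ + 0
  sum-0 zero = refl
  sum-0 (suc n) = trans (ℤₚ.+-identityʳ _) (sum-0 n)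

  sum-const : ∀ c n → sumBelow (λ _ → c) n ≡ + n * c
  sum-const c zero = sym (ℤₚ.*-zeroˡ c)
  sum-const c (suc n) = trans (cong (_+ c) (sum-const c n)) (lemma (+ n) c)
    where
    lemma : ∀ n c → n * c + c ≡ (+ 1 + n) * c
    lemma = ℤ-Ring.solve-∀

  sum-+ : ∀ (f g : ℕ → ℤ) n → sumBelow (λ k → f k + g k) n ≡ sumBelow f n + sumBelow g n
  sum-+ f g zero = refl
  sum-+ f g (suc n) = trans (cong (_+ (f n + g n)) (sum-+ f g n)) (lemma (sumBelow f n) (sumBelow g n) (f n) (g n))
    where
    lemma : ∀ a b c d → a + b + (c + d) ≡ a + c + (b + d)
    lemma = ℤ-Ring.solve-∀

  sum-swap : ∀ (f : ℕ → ℕ → ℤ) m n →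
    sumBelow (λ j → sumBelow (λ i → f i j) m) n ≡ sumBelow (λ i → sumBelow (f i) n) m
  sum-swap f m zero = sym (sum-0 m)
  sum-swap f m (suc n) = trans (cong (_+ sumBelow (λ i → f i n) m) (sum-swap f m n))
    (sym (sum-+ (λ i → sumBelow (f i) n) (λ i → f i n) m))

  sum-extend : ∀ (f : ℕ → ℤ) {m n} → m ≤ n → (∀ k → m ≤ k → f k ≡ + 0) → sumBelow f m ≡ sumBelow f n
  sum-extend f {n = zero} z≤n vanish = refl
  sum-extend f {m} {suc n} m≤1+n vanish with ℕₚ.m≤n⇒m<n∨m≡n m≤1+n
  ... | inj₂ refl = refl

  ... | inj₁ m<1+n = trans (sum-extend f (ℕₚ.≤-pred m<1+n) vanish)
    (sym (trans (cong (_+_ (sumBelow f n)) (vanish n (ℕₚ.≤-pred m<1+n))) (ℤₚ.+-identityʳ _)))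

  mono-≡ : ∀ c k → mono c k k ≡ c
  mono-≡ c k rewrite dec-true (k ℕ.≟ k) refl = refl

  mono-≢ : ∀ c {k n} → n ≢ k → mono c k n ≡ + 0
  mono-≢ c {k} {n} n≢k rewrite dec-false (n ℕ.≟ k) n≢k = refl

  jump : ℤ → ℕ → ℕ → ℤ
  jump c a n = sumBelow (mono c a) (suc n)

  jump-< : ∀ c {a n} → n < a → jump c a n ≡ + 0
  jump-< c {a} {n} n<a = trans
    (sum-cong (suc n) (λ k k≤n → mono-≢ c (ℕₚ.<⇒≢ (ℕₚ.<-≤-trans k≤n n<a)))) (sum-0 (suc n))

  jump-≤ : ∀ c {a n} → a ≤ n → jump c a n ≡ c
  jump-≤ c {a} {n} a≤n = trans (sym (sum-extend (mono c a) {suc a} (s≤s a≤n)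
    (λ k a<k → mono-≢ c (ℕₚ.>⇒≢ a<k)))) (trans (cong (_+ mono c a a) (before a))
    (trans (ℤₚ.+-identityˡ _) (mono-≡ c a)))
    where
    before : ∀ a → sumBelow (mono c a) a ≡ + 0
    before a = trans (sum-cong a (λ k k<a → mono-≢ c (ℕₚ.<⇒≢ k<a))) (sum-0 a)

  jump-cong : ∀ c {a n b m} → (a ≤ n → b ≤ m) → (b ≤ m → a ≤ n) → jump c a n ≡ jump c b m
  jump-cong c {a} {n} to from with a ℕ.≤? n
  ... | yes a≤n = trans (jump-≤ c a≤n) (sym (jump-≤ c (to a≤n)))
  ... | no a≰n = trans (jump-< c (ℕₚ.≰⇒> a≰n)) (sym (jump-< c (ℕₚ.≰⇒> (a≰n ∘ from))))

  ⊗-step : ∀ (F f b : FPS) → F 0 ≡ f 0 → (∀ k → F (suc k) ≡ F k + f (suc k)) →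
    ∀ n → (F ⊗ b) (suc n) ≡ (F ⊗ b) n + (f ⊗ b) (suc n)
  ⊗-step F f b F0 F+ n = begin
    (F ⊗ b) (suc n)
      ≡⟨ sum-head (λ k → F k * b (suc n ∸ k)) (suc n) ⟩
    F 0 * b (suc n) + sumBelow (λ k → F (suc k) * b (n ∸ k)) (suc n)
      ≡⟨ cong₂ _+_ (cong (_* b (suc n)) F0) (trans
           (sum-cong (suc n) (λ k _ → trans (cong (_* b (n ∸ k)) (F+ k))
               (ℤₚ.*-distribʳ-+ (b (n ∸ k)) (F k) (f (suc k)))))
           (sum-+ _ _ (suc n))) ⟩
    f 0 * b (suc n) + ((F ⊗ b) n + sumBelow (λ k → f (suc k) * b (n ∸ k)) (suc n))
      ≡⟨ lemma (f 0 * b (suc n)) ((F ⊗ b) n) (sumBelow (λ k → f (suc k) * b (n ∸ k)) (suc n)) ⟩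
    (F ⊗ b) n + (f 0 * b (suc n) + sumBelow (λ k → f (suc k) * b (n ∸ k)) (suc n))
      ≡⟨ cong (_+_ ((F ⊗ b) n)) (sym (sum-head (λ k → f k * b (suc n ∸ k)) (suc n))) ⟩
    (F ⊗ b) n + (f ⊗ b) (suc n) ∎
    where
    open ≡-Reasoning
    lemma : ∀ a b c → a + (b + c) ≡ b + (a + c)
    lemma = ℤ-Ring.solve-∀

  geom-⊗-step : ∀ (b : FPS) n → (geom ⊗ b) (suc n) ≡ (geom ⊗ b) n + b (suc n)
  geom-⊗-step b n = trans (sum-head (λ k → geom k * b (suc n ∸ k)) (suc n))
    (trans (cong (_+ (geom ⊗ b) n) (ℤₚ.*-identityˡ (b (suc n)))) (ℤₚ.+-comm (b (suc n)) ((geom ⊗ b) n)))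

  mono-⊗-suc : ∀ c k (b : FPS) n → (mono c (suc k) ⊗ b) (suc n) ≡ (mono c k ⊗ b) n
  mono-⊗-suc c k b n = trans (sum-head (λ j → mono c (suc k) j * b (suc n ∸ j)) (suc n))
    (trans (cong (_+ (mono c k ⊗ b) n) (ℤₚ.*-zeroˡ (b (suc n)))) (ℤₚ.+-identityˡ _))

  mono-⊗-zero : ∀ c (b : FPS) n → (mono c 0 ⊗ b) n ≡ c * b n
  mono-⊗-zero c b n = trans (sum-head (λ j → mono c 0 j * b (n ∸ j)) n)
    (trans (cong (_+_ (c * b n)) (trans (sum-cong n (λ k _ → ℤₚ.*-zeroˡ (b (n ∸ suc k)))) (sum-0 n)))
      (ℤₚ.+-identityʳ _))

  module Series (q : ℕ) (2≤q : 2 ≤ q)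
    (half-square : + 2 * + ((q ℕ.* q) / 2) ≡ (+ suc q - + 1) * (+ suc q - + 1)) where

    p : ℕ
    p = suc q

    P c : ℤ
    P = + p
    c = + ((q ℕ.* q) / 2)

    h d e : FPS
    h = rhs p
    d = geom ⊗ geom ⊗ numerator p
    e = geom ⊗ numerator p

    h-step : ∀ n → h (suc n) ≡ h n + d (suc n)
    h-step = ⊗-step (geom ⊗ geom ⊗ geom) (geom ⊗ geom) (numerator p) refl
      (λ k → cong (_+_ ((geom ⊗ geom ⊗ geom) k)) (ℤₚ.*-identityʳ ((geom ⊗ geom) (suc k))))

    d-step : ∀ n → d (suc n) ≡ d n + e (suc n)
    d-step = ⊗-step (geom ⊗ geom) geom (numerator p) refl (λ k → refl)

    e-step : ∀ n → e (suc n) ≡ e n + numerator p (suc n)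
    e-step = geom-⊗-step (numerator p)

    K₂ : ℤ
    K₂ = P * P - + 3 * P + + 3

    inner-part : FPS
    inner-part = mono c 2 ⊗ innerSum p

    inner-part-2+ : ∀ n → inner-part (suc (suc n)) ≡ c * innerSum p n
    inner-part-2+ n = trans (mono-⊗-suc c 1 (innerSum p) (suc n))
      (trans (mono-⊗-suc c 0 (innerSum p) n) (mono-⊗-zero c (innerSum p) n))

    numerator-0 : numerator p 0 ≡ + 1
    numerator-0 = lemma (innerSum p 0)
      where
      lemma : ∀ x → + 1 + + 0 + + 0 + (+ 0 + + 0 * x) ≡ + 1
      lemma = ℤ-Ring.solve-∀

    numerator-1 : numerator p 1 ≡ P - + 3
    numerator-1 = trans (cong (_+_ (+ 0 + (P - + 3) + + 0)) (mono-⊗-suc c 1 (innerSum p) 0))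
      (lemma (P - + 3) (innerSum p 0))
      where
      lemma : ∀ y x → + 0 + y + + 0 + (+ 0 + + 0 * x) ≡ y
      lemma = ℤ-Ring.solve-∀

    numerator-2 : numerator p 2 ≡ K₂ + c * innerSum p 0
    numerator-2 = trans (cong (_+_ (+ 0 + + 0 + K₂)) (inner-part-2+ 0))
        (cong (_+ c * innerSum p 0) (ℤₚ.+-identityˡ K₂))

    numerator-3+ : ∀ n → numerator p (suc (suc (suc n))) ≡ c * innerSum p (suc n)
    numerator-3+ n = trans (cong (_+_ (+ 0 + + 0 + + 0)) (inner-part-2+ (suc n))) (ℤₚ.+-identityˡ _)

    S : ℕ → ℤ
    S n = sumBelow (innerSum p) (suc n)

    e-0 : e 0 ≡ + 1
    e-0 = trans (ℤₚ.+-identityˡ _) (trans (ℤₚ.*-identityˡ _) numerator-0)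

    e-1 : e 1 ≡ P - + 2
    e-1 = trans (e-step 0) (trans (cong₂ _+_ e-0 numerator-1) (lemma P))
      where
      lemma : ∀ x → + 1 + (x - + 3) ≡ x - + 2
      lemma = ℤ-Ring.solve-∀

    e-2+ : ∀ n → e (suc (suc n)) ≡ (P - + 1) * (P - + 1) + c * S n
    e-2+ zero = trans (e-step 1) (trans (cong₂ _+_ e-1 numerator-2) (lemma P c (innerSum p 0)))
      where
      lemma : ∀ x c y → x - + 2 + (x * x - + 3 * x + + 3 + c * y) ≡ (x - + 1) * (x - + 1) + c * (+ 0 + y)
      lemma = ℤ-Ring.solve-∀
    e-2+ (suc n) = trans (e-step (suc (suc n))) (trans (cong₂ _+_ (e-2+ n) (numerator-3+ n))
      (lemma ((P - + 1) * (P - + 1)) c (S n) (innerSum p (suc n))))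
      where
      lemma : ∀ x c y z → x + c * y + c * z ≡ x + c * (y + z)
      lemma = ℤ-Ring.solve-∀

    c₂ c₃ : ℤ
    c₂ = - (+ 2 * (P - + 1))
    c₃ = P - + 2

    T : ℕ → ℕ → ℤ
    T i n = jump P (p ^ i) n + jump c₂ (2 ℕ.* p ^ i) n + jump c₃ (3 ℕ.* p ^ i) n

    n<p^n : ∀ n → n < p ^ n
    n<p^n = n<m^n (s≤s (ℕₚ.≤-trans (s≤s z≤n) 2≤q))

    T-< : ∀ i {n} → n < p ^ i → T i n ≡ + 0
    T-< i n<p^i = cong₂ _+_ (cong₂ _+_ (jump-< P n<p^i)
      (jump-< c₂ (ℕₚ.<-≤-trans n<p^i (ℕₚ.m≤n*m (p ^ i) 2)))) (jump-< c₃ (ℕₚ.<-≤-trans n<p^i (ℕₚ.m≤n*m (p ^ i) 3)))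

    S-as-T : ∀ n {m} → n < m → S n ≡ sumBelow (λ i → T i n) m
    S-as-T n {m} n<m = begin
      S n
        ≡⟨ sum-cong (suc n) (λ j j≤n → sum-extend (term j) {suc j} {suc n} j≤n
             (λ i j<i → term-< i (ℕₚ.<-trans j<i (n<p^n i)))) ⟩
      sumBelow (λ j → sumBelow (term j) (suc n)) (suc n)
        ≡⟨ sum-swap (λ i j → term j i) (suc n) (suc n) ⟩
      sumBelow (λ i → sumBelow (λ j → term j i) (suc n)) (suc n)
        ≡⟨ sum-cong (suc n) (λ i _ → trans (sum-+ _ _ (suc n))
            (cong (_+ jump c₃ (3 ℕ.* p ^ i) n) (sum-+ _ _ (suc n)))) ⟩
      sumBelow (λ i → T i n) (suc n)
        ≡⟨ sum-extend (λ i → T i n) n<m (λ i n<i → T-< i (ℕₚ.<-trans n<i (n<p^n i))) ⟩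
      sumBelow (λ i → T i n) m ∎
      where
      open ≡-Reasoning
      term : ℕ → ℕ → ℤ
      term j i = mono P (p ^ i) j + mono c₂ (2 ℕ.* p ^ i) j + mono c₃ (3 ℕ.* p ^ i) j
      term-< : ∀ i {j} → j < p ^ i → term j i ≡ + 0
      term-< i j<p^i = cong₂ _+_ (cong₂ _+_ (mono-≢ P (ℕₚ.<⇒≢ j<p^i))
        (mono-≢ c₂ (ℕₚ.<⇒≢ (ℕₚ.<-≤-trans j<p^i (ℕₚ.m≤n*m (p ^ i) 2)))))
        (mono-≢ c₃ (ℕₚ.<⇒≢ (ℕₚ.<-≤-trans j<p^i (ℕₚ.m≤n*m (p ^ i) 3))))

    *≤⇒≤/ : ∀ a {n} → a ℕ.* p ≤ n → a ≤ n / p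
    *≤⇒≤/ a a*p≤n = subst (_≤ _) (DM.m*n/n≡m a p) (DM./-monoˡ-≤ p a*p≤n)

    ≤/⇒*≤ : ∀ {a} n → a ≤ n / p → a ℕ.* p ≤ n
    ≤/⇒*≤ n a≤n/p = ℕₚ.≤-trans (ℕₚ.*-monoˡ-≤ p a≤n/p) (DM.m/n*n≤m n p)

    jump-/ : ∀ z a i n → jump z (a ℕ.* p ^ suc i) n ≡ jump z (a ℕ.* p ^ i) (n / p)
    jump-/ z a i n = jump-cong z
      (λ le → *≤⇒≤/ (a ℕ.* p ^ i) (subst (_≤ n) eq le)) (λ le → subst (_≤ n) (sym eq) (≤/⇒*≤ n le))
      where
      eq : a ℕ.* p ^ suc i ≡ a ℕ.* p ^ i ℕ.* p
      eq = trans (cong (a ℕ.*_) (ℕₚ.*-comm p (p ^ i))) (sym (ℕₚ.*-assoc a (p ^ i) p))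

    T-/ : ∀ i n → T (suc i) n ≡ T i (n / p)
    T-/ i n = cong₂ _+_ (cong₂ _+_
      (trans (cong (λ x → jump P x n) (sym (ℕₚ.*-identityˡ (p ^ suc i))))
        (trans (jump-/ P 1 i n) (cong (λ x → jump P x (n / p)) (ℕₚ.*-identityˡ (p ^ i)))))
      (jump-/ c₂ 2 i n)) (jump-/ c₃ 3 i n)

    S-head : ∀ n → S n ≡ T 0 n + S (n / p)
    S-head n = trans (S-as-T n (ℕₚ.m<n⇒m<1+n ℕₚ.≤-refl))
      (trans (sum-head (λ i → T i n) (suc n)) (cong (_+_ (T 0 n))
        (trans (sum-cong (suc n) (λ i _ → T-/ i n)) (sym (S-as-T (n / p) (s≤s (DM.m/n≤m n p)))))))

    -- From 3 on, the three jumps P, c₂ and c₃ of the first term have all occurred and cancel.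
    S-/ : ∀ {n} → 3 ≤ n → S n ≡ S (n / p)
    S-/ {n} 3≤n = trans (S-head n) (trans (cong (_+ S (n / p)) T-0) (ℤₚ.+-identityˡ _))
      where
      lemma : ∀ x → x + - (+ 2 * (x - + 1)) + (x - + 2) ≡ + 0
      lemma = ℤ-Ring.solve-∀
      T-0 : T 0 n ≡ + 0
      T-0 = trans (cong₂ _+_ (cong₂ _+_ (jump-≤ P (ℕₚ.≤-trans (s≤s z≤n) 3≤n))
        (jump-≤ c₂ (ℕₚ.≤-trans (s≤s (s≤s z≤n)) 3≤n))) (jump-≤ c₃ 3≤n)) (lemma P)

    small/p : ∀ {n} → n ≤ 2 → n / p ≡ 0
    small/p n≤2 = DM.m<n⇒m/n≡0 (s≤s (ℕₚ.≤-trans n≤2 2≤q))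

    S-small : ∀ n → n ≤ 2 → S n ≡ T 0 n
    S-small n n≤2 = trans (S-head n) (trans (cong (λ x → T 0 n + S x) (small/p n≤2)) (ℤₚ.+-identityʳ _))

    e-2+-/ : ∀ {n} → 3 ≤ n → e (suc (suc n)) ≡ e (suc (suc (n / p)))
    e-2+-/ {n} 3≤n = trans (e-2+ n) (trans (cong (λ x → (P - + 1) * (P - + 1) + c * x) (S-/ 3≤n))
        (sym (e-2+ (n / p))))

    slide : ∀ (φ : ℕ → ℤ) x → sumBelow (λ s → φ ((suc x ℕ.+ s) / p)) p
          ≡ sumBelow (λ s → φ ((x ℕ.+ s) / p)) p + (φ (suc (x / p)) - φ (x / p))
    slide φ x = begin
      rest
        ≡⟨ lemma (φ (x / p)) rest ⟩
      φ (x / p) + rest - φ (x / p)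
        ≡⟨ cong (_- φ (x / p)) (cong₂ _+_ (cong (λ y → φ (y / p)) (sym (ℕₚ.+-identityʳ x)))
             (sum-cong p (λ s _ → cong (λ y → φ (y / p)) (sym (ℕₚ.+-suc x s))))) ⟩
      f 0 + sumBelow (f ∘ suc) p - φ (x / p)
        ≡⟨ cong (_- φ (x / p)) (sym (sum-head f p)) ⟩
      sumBelow f p + f p - φ (x / p)
        ≡⟨ cong (λ y → sumBelow f p + φ y - φ (x / p)) [x+p]/p ⟩
      sumBelow f p + φ (suc (x / p)) - φ (x / p)
        ≡⟨ ℤₚ.+-assoc (sumBelow f p) (φ (suc (x / p))) (- φ (x / p)) ⟩
      sumBelow f p + (φ (suc (x / p)) - φ (x / p)) ∎
      where
      open ≡-Reasoning
      f = λ s → φ ((x ℕ.+ s) / p)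
      rest = sumBelow (λ s → φ ((suc x ℕ.+ s) / p)) p
      lemma : ∀ a b → b ≡ a + b - a
      lemma = ℤ-Ring.solve-∀
      [x+p]/p : (x ℕ.+ p) / p ≡ suc (x / p)
      [x+p]/p = trans (DM.+-distrib-/-∣ʳ x ∣-refl) (trans (cong (x / p ℕ.+_) (DM.n/n≡1 p)) (ℕₚ.+-comm (x / p) 1))

    windowSum doubleSum doubleDiff : ℕ → ℤ
    windowSum x = sumBelow (λ s → h ((x ℕ.+ s) / p)) p
    doubleSum n = sumBelow (λ k → windowSum (n ℕ.+ k)) p
    doubleDiff n = sumBelow (λ k → d (suc ((n ℕ.+ k) / p))) p

    windowSum-suc : ∀ x → windowSum (suc x) ≡ windowSum x + d (suc (x / p))
    windowSum-suc x = trans (slide h x) (cong (_+_ (windowSum x))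
      (trans (cong (_- h (x / p)) (h-step (x / p))) (lemma (h (x / p)) (d (suc (x / p))))))
      where
      lemma : ∀ a b → a + b - a ≡ b
      lemma = ℤ-Ring.solve-∀

    doubleSum-suc : ∀ n → doubleSum (suc n) ≡ doubleSum n + doubleDiff n
    doubleSum-suc n = trans (sum-cong p (λ k _ → windowSum-suc (n ℕ.+ k)))
      (sum-+ (λ k → windowSum (n ℕ.+ k)) (λ k → d (suc ((n ℕ.+ k) / p))) p)

    doubleDiff-suc : ∀ n → doubleDiff (suc n) ≡ doubleDiff n + e (suc (suc (n / p)))
    doubleDiff-suc n = trans (slide (d ∘ suc) n) (cong (_+_ (doubleDiff n))
      (trans (cong (_- d (suc (n / p))) (d-step (suc (n / p)))) (lemma (d (suc (n / p))) (e (suc (suc (n / p)))))))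
      where
      lemma : ∀ a b → a + b - a ≡ b
      lemma = ℤ-Ring.solve-∀

    Q² : ℤ
    Q² = (P - + 1) * (P - + 1)

    e-2 : e 2 ≡ Q²
    e-2 = trans (e-2+ 0) (trans (cong (λ x → Q² + c * x) (S-small 0 z≤n)) (lemma Q² c))
      where
      lemma : ∀ x c → x + c * + 0 ≡ x
      lemma = ℤ-Ring.solve-∀

    e-3 : e 3 ≡ Q² + c * P
    e-3 = trans (e-2+ 1) (cong (λ x → Q² + c * x) (trans (S-small 1 (s≤s z≤n))
      (trans (cong₂ _+_ (cong₂ _+_ (jump-≤ P {1} {1} ℕₚ.≤-refl) (jump-< c₂ {2} {1} ℕₚ.≤-refl))
        (jump-< c₃ {3} {1} (s≤s (s≤s z≤n)))) (trans (ℤₚ.+-identityʳ (P + + 0)) (ℤₚ.+-identityʳ P)))))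

    e-4 : e 4 ≡ Q² + c * (P + c₂)
    e-4 = trans (e-2+ 2) (cong (λ x → Q² + c * x) (trans (S-small 2 (s≤s (s≤s z≤n)))
      (trans (cong₂ _+_ (cong₂ _+_ (jump-≤ P {1} {2} (s≤s z≤n)) (jump-≤ c₂ {2} {2} ℕₚ.≤-refl))
        (jump-< c₃ {3} {2} ℕₚ.≤-refl)) (ℤₚ.+-identityʳ (P + c₂)))))

    d-0 : d 0 ≡ + 1
    d-0 = trans (ℤₚ.+-identityˡ _) (trans (ℤₚ.*-identityˡ _) numerator-0)

    d-1 : d 1 ≡ P - + 1
    d-1 = trans (d-step 0) (trans (cong₂ _+_ d-0 e-1) (lemma P))
      where
      lemma : ∀ x → + 1 + (x - + 2) ≡ x - + 1
      lemma = ℤ-Ring.solve-∀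

    h-0 : h 0 ≡ + 1
    h-0 = trans (ℤₚ.+-identityˡ _) (trans (ℤₚ.*-identityˡ _) numerator-0)

    h-1 : h 1 ≡ P
    h-1 = trans (h-step 0) (trans (cong₂ _+_ h-0 d-1) (lemma P))
      where
      lemma : ∀ x → + 1 + (x - + 1) ≡ x
      lemma = ℤ-Ring.solve-∀

    d-2 : d 2 ≡ P - + 1 + Q²
    d-2 = trans (d-step 1) (cong₂ _+_ d-1 e-2)

    h-2 : h 2 ≡ P * P
    h-2 = trans (h-step 1) (trans (cong₂ _+_ h-1 d-2) (lemma P))
      where
      lemma : ∀ x → x + (x - + 1 + (x - + 1) * (x - + 1)) ≡ x * x
      lemma = ℤ-Ring.solve-∀

    d-3 : d 3 ≡ P - + 1 + Q² + (Q² + c * P)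
    d-3 = trans (d-step 2) (cong₂ _+_ d-2 e-3)

    d-4 : d 4 ≡ P - + 1 + Q² + (Q² + c * P) + (Q² + c * (P + c₂))
    d-4 = trans (d-step 3) (cong₂ _+_ d-3 e-4)

    doubleDiff-0 : doubleDiff 0 ≡ P * (P - + 1)
    doubleDiff-0 = trans (sum-cong p (λ k k<p → trans (cong (d ∘ suc) (DM.m<n⇒m/n≡0 k<p)) d-1))
        (sum-const (P - + 1) p)

    doubleDiff-small : ∀ n → n ≤ 2 → doubleDiff (suc n) ≡ doubleDiff n + Q²
    doubleDiff-small n n≤2 = trans (doubleDiff-suc n)
      (cong (_+_ (doubleDiff n)) (trans (cong (λ x → e (suc (suc x))) (small/p n≤2)) e-2))

    windowSum-small : ∀ k → k ≤ p → windowSum k ≡ P + + k * (P - + 1)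
    windowSum-small zero _ = trans (sum-cong p (λ s s<p → trans (cong h (DM.m<n⇒m/n≡0 s<p)) h-0))
      (trans (sum-const (+ 1) p) (lemma P))
      where
      lemma : ∀ x → x * + 1 ≡ x + + 0 * (x - + 1)
      lemma = ℤ-Ring.solve-∀
    windowSum-small (suc k) k<p = trans (windowSum-suc k) (trans
      (cong₂ _+_ (windowSum-small k (ℕₚ.<⇒≤ k<p)) (trans (cong (d ∘ suc) (DM.m<n⇒m/n≡0 k<p)) d-1))
      (lemma P (P - + 1) (+ k)))
      where
      lemma : ∀ x y k → x + k * y + y ≡ x + (+ 1 + k) * y
      lemma = ℤ-Ring.solve-∀

    triangle : ∀ n y → + 2 * sumBelow (λ k → + k * y) n ≡ + n * (+ n - + 1) * y
    triangle zero y = refl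
    triangle (suc n) y = trans (ℤₚ.*-distribˡ-+ (+ 2) (sumBelow (λ k → + k * y) n) (+ n * y))
      (trans (cong (_+ + 2 * (+ n * y)) (triangle n y)) (lemma (+ n) y))
      where
      lemma : ∀ n y → n * (n - + 1) * y + + 2 * (n * y) ≡ (+ 1 + n) * ((+ 1 + n) - + 1) * y
      lemma = ℤ-Ring.solve-∀

    doubleSum-0 : doubleSum 0 ≡ P * P + P * c
    doubleSum-0 = trans (sum-cong p (λ k k<p → windowSum-small k (ℕₚ.<⇒≤ k<p)))
      (trans (sum-+ (λ _ → P) (λ k → + k * (P - + 1)) p)
        (cong₂ _+_ (sum-const P p) (ℤₚ.*-cancelˡ-≡ (+ 2) _ _
          (trans (triangle p (P - + 1)) (trans (lemma₁ P) (trans (cong (P *_) (sym half-square)) (lemma₂ P c)))))))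
      where
      lemma₁ : ∀ x → x * (x - + 1) * (x - + 1) ≡ x * ((x - + 1) * (x - + 1))
      lemma₁ = ℤ-Ring.solve-∀
      lemma₂ : ∀ x c → x * (+ 2 * c) ≡ + 2 * (x * c)
      lemma₂ = ℤ-Ring.solve-∀

    overcount degenerates : ℤ
    overcount = P * P + + 3 * (P * (P - + 1))
    degenerates = + 1 + + 3 * (P - + 1)

    doubleDiff-3 : doubleDiff 3 ≡ d 4
    doubleDiff-3 = begin
      doubleDiff 3
        ≡⟨ doubleDiff-small 2 ℕₚ.≤-refl ⟩
      doubleDiff 2 + Q²
        ≡⟨ cong (_+ Q²) (trans (doubleDiff-small 1 (s≤s z≤n)) (cong (_+ Q²)
             (trans (doubleDiff-small 0 z≤n) (cong (_+ Q²) doubleDiff-0)))) ⟩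
      P * (P - + 1) + Q² + Q² + Q²
        ≡⟨ lemma₁ P ⟩
      P - + 1 + Q² + Q² + Q² + Q²
        ≡⟨ cong (_+_ (P - + 1 + Q² + Q² + Q²)) (sym half-square) ⟩
      P - + 1 + Q² + Q² + Q² + + 2 * c
        ≡⟨ lemma₂ P c Q² ⟩
      P - + 1 + Q² + (Q² + c * P) + (Q² + c * (P + c₂))
        ≡⟨ sym d-4 ⟩
      d 4 ∎
      where
      open ≡-Reasoning
      lemma₁ : ∀ x → let y = (x - + 1) * (x - + 1) in
        x * (x - + 1) + y + y + y ≡ x - + 1 + y + y + y + y
      lemma₁ = ℤ-Ring.solve-∀
      lemma₂ : ∀ x c y → x - + 1 + y + y + y + + 2 * c
        ≡ x - + 1 + y + (y + c * x) + (y + c * (x + - (+ 2 * (x - + 1))))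
      lemma₂ = ℤ-Ring.solve-∀

    doubleSum-3 : doubleSum 3 - overcount + degenerates ≡ h 3
    doubleSum-3 = begin
      doubleSum 3 - overcount + degenerates
        ≡⟨ cong (λ x → x - overcount + degenerates) (trans (doubleSum-suc 2)
             (cong₂ _+_ (trans (doubleSum-suc 1) (cong₂ _+_ (trans (doubleSum-suc 0)
               (cong₂ _+_ doubleSum-0 doubleDiff-0)) m₁)) m₂)) ⟩
      P * P + P * c + P * (P - + 1) + (P * (P - + 1) + Q²) + (P * (P - + 1) + Q² + Q²) - overcount + degenerates
        ≡⟨ lemma P c ⟩
      P * P + (P - + 1 + Q² + (Q² + c * P))
        ≡⟨ sym (trans (h-step 2) (cong₂ _+_ h-2 d-3)) ⟩
      h 3 ∎
      where
      open ≡-Reasoning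
      m₁ = trans (doubleDiff-small 0 z≤n) (cong (_+ Q²) doubleDiff-0)
      m₂ = trans (doubleDiff-small 1 (s≤s z≤n)) (cong (_+ Q²) m₁)
      lemma : ∀ x c → let y = (x - + 1) * (x - + 1) in
        x * x + x * c + x * (x - + 1) + (x * (x - + 1) + y) + (x * (x - + 1) + y + y)
          - (x * x + + 3 * (x * (x - + 1))) + (+ 1 + + 3 * (x - + 1))
        ≡ x * x + (x - + 1 + y + (y + c * x))
      lemma = ℤ-Ring.solve-∀

    rhs-recurrence′ : ∀ n → doubleSum (3 ℕ.+ n) - overcount + degenerates ≡ h (3 ℕ.+ n)
                          × doubleDiff (3 ℕ.+ n) ≡ d (4 ℕ.+ n)
    rhs-recurrence′ zero = doubleSum-3 , doubleDiff-3
    rhs-recurrence′ (suc n) with rhs-recurrence′ n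
    ... | sumEq , diffEq =
      trans (cong (λ x → x - overcount + degenerates) (doubleSum-suc (3 ℕ.+ n)))
        (trans (lemma (doubleSum (3 ℕ.+ n)) (doubleDiff (3 ℕ.+ n)) overcount degenerates)
          (trans (cong₂ _+_ sumEq diffEq) (sym (h-step (3 ℕ.+ n)))))
      , trans (doubleDiff-suc (3 ℕ.+ n)) (trans (cong₂ _+_ diffEq (sym (e-2+-/ (ℕₚ.m≤m+n 3 n))))
          (sym (d-step (4 ℕ.+ n))))
      where
      lemma : ∀ a b x y → a + b - x + y ≡ a - x + y + b
      lemma = ℤ-Ring.solve-∀

    rhs-recurrence : ∀ {n} → 3 ≤ n → doubleSum n - overcount + degenerates ≡ h n
    rhs-recurrence {n} 3≤n = subst (λ m → doubleSum m - overcount + degenerates ≡ h m)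
      (ℕₚ.m+[n∸m]≡n 3≤n) (proj₁ (rhs-recurrence′ (n ∸ 3)))

-- Binomial coefficients modulo p

module _ where
  open import Data.Nat using (_+_; _*_)

  private variable A : Set

  applyUpTo-cong : ∀ {f g : ℕ → A} n → (∀ t → t < n → f t ≡ g t) → applyUpTo f n ≡ applyUpTo g n
  applyUpTo-cong zero eq = refl
  applyUpTo-cong (suc n) eq = cong₂ _∷_ (eq 0 (s≤s z≤n)) (applyUpTo-cong n (λ t t<n → eq (suc t) (s≤s t<n)))

  applyUpTo-injective : ∀ (f g : ℕ → A) n → applyUpTo f n ≡ applyUpTo g n → ∀ {t} → t < n → f t ≡ g t
  applyUpTo-injective f g (suc n) eq {zero} _ = proj₁ (∷-injective eq)
  applyUpTo-injective f g (suc n) eq {suc t} (s≤s t<n) = applyUpTo-injective (f ∘ suc) (g ∘ suc) n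
      (proj₂ (∷-injective eq)) t<n

  applyUpTo-+ : ∀ (f : ℕ → A) a b → applyUpTo f (a + b) ≡ applyUpTo f a ++ applyUpTo (f ∘ (_+_ a)) b
  applyUpTo-+ f zero b = refl
  applyUpTo-+ f (suc a) b = cong (f 0 ∷_) (applyUpTo-+ (f ∘ suc) a b)

  substring-applyUpTo⁺ : ∀ (f : ℕ → ℕ) {N} j n → j + n ≤ N → Substring (applyUpTo (f ∘ (_+_ j)) n) (applyUpTo f N)
  substring-applyUpTo⁺ f {N} j n j+n≤N = applyUpTo f j , applyUpTo (f ∘ (_+_ j) ∘ (_+_ n)) (N ∸ (j + n)) ,
    trans (cong (applyUpTo f j ++_) (sym (applyUpTo-+ (f ∘ (_+_ j)) n (N ∸ (j + n)))))
      (trans (sym (applyUpTo-+ f j (n + (N ∸ (j + n)))))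
        (cong (applyUpTo f) (trans (sym (ℕₚ.+-assoc j n _)) (ℕₚ.m+[n∸m]≡n j+n≤N))))

  substring-applyUpTo⁻ : ∀ (f : ℕ → ℕ) N {b} → Substring b (applyUpTo f N) →
    ∃ λ j → b ≡ applyUpTo (f ∘ (_+_ j)) (length b)
  substring-applyUpTo⁻ f N (u , v , eq) = length u , go f N u eq
    where
    prefix : ∀ (f : ℕ → ℕ) N {v} b → b ++ v ≡ applyUpTo f N → b ≡ applyUpTo f (length b)
    prefix f N [] eq = refl
    prefix f (suc N) (x ∷ b) eq =
      cong₂ _∷_ (proj₁ (∷-injective eq)) (prefix (f ∘ suc) N b (proj₂ (∷-injective eq)))
    go : ∀ (f : ℕ → ℕ) N {b v} u → u ++ b ++ v ≡ applyUpTo f N → b ≡ applyUpTo (f ∘ (_+_ (length u))) (length b)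
    go f N {b} [] eq = prefix f N b eq
    go f (suc N) (x ∷ u) eq = go (f ∘ suc) N u (proj₂ (∷-injective eq))

  polyAdd-applyUpTo : ∀ (f g : ℕ → ℤ) n → f n ≡ + 0 →
    polyAdd (applyUpTo f n) (applyUpTo g (suc n)) ≡ applyUpTo (λ j → f j ℤ.+ g j) (suc n)
  polyAdd-applyUpTo f g zero f0 = cong (_∷ []) (sym (trans (cong (ℤ._+ g 0) f0) (ℤₚ.+-identityˡ (g 0))))
  polyAdd-applyUpTo f g (suc n) fn = cong (f 0 ℤ.+ g 0 ∷_) (polyAdd-applyUpTo (f ∘ suc) (g ∘ suc) n fn)

  polyPow-onePlusX : ∀ i → polyPow onePlusX i ≡ applyUpTo (λ j → + (i C j)) (suc i)
  polyPow-onePlusX zero = refl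
  polyPow-onePlusX (suc i) = begin
    polyMul onePlusX (polyPow onePlusX i)
      ≡⟨ cong (polyMul onePlusX) (polyPow-onePlusX i) ⟩
    polyAdd (map (ℤ._*_ (+ 1)) r) (+ 0 ∷ polyAdd (map (ℤ._*_ (+ 1)) r) (+ 0 ∷ []))
      ≡⟨ cong (λ r′ → polyAdd r′ (+ 0 ∷ polyAdd r′ (+ 0 ∷ []))) (trans (map-cong ℤₚ.*-identityˡ r) (map-id r)) ⟩
    polyAdd r (+ 0 ∷ polyAdd r (+ 0 ∷ []))
      ≡⟨ cong (λ r′ → polyAdd r (+ 0 ∷ r′)) (add-0 (+ (i C 0)) (applyUpTo (f ∘ suc) i)) ⟩
    polyAdd r (applyUpTo shifted (suc (suc i)))
      ≡⟨ polyAdd-applyUpTo f shifted (suc i) (cong +_ (k>n⇒nCk≡0 (ℕₚ.n<1+n i))) ⟩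
    applyUpTo (λ j → f j ℤ.+ shifted j) (suc (suc i))
      ≡⟨ applyUpTo-cong (suc (suc i)) (λ j _ → coefficient j) ⟩
    applyUpTo (λ j → + (suc i C j)) (suc (suc i)) ∎
    where
    open ≡-Reasoning
    f shifted : ℕ → ℤ
    f j = + (i C j)
    shifted zero = + 0
    shifted (suc j) = f j
    r = applyUpTo f (suc i)
    coefficient : ∀ j → f j ℤ.+ shifted j ≡ + (suc i C j)
    coefficient zero = refl
    coefficient (suc j) = cong +_ (trans (ℕₚ.+-comm (i C suc j) (i C j)) (nCk+nC[k+1]≡[n+1]C[k+1] i j))
    add-0 : ∀ a as → polyAdd (a ∷ as) (+ 0 ∷ []) ≡ a ∷ as
    add-0 a [] = cong (_∷ []) (ℤₚ.+-identityʳ a)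
    add-0 a (_ ∷ _) = cong (_∷ _) (ℤₚ.+-identityʳ a)

  absorption : ∀ k l → suc l * (suc k C suc l) ≡ suc k * (k C l)
  absorption k zero = trans (ℕₚ.*-identityˡ _) (trans (nC1≡n (suc k)) (sym (ℕₚ.*-identityʳ (suc k))))
  absorption zero (suc l) = trans (cong (suc (suc l) *_) (k>n⇒nCk≡0 {1} {suc (suc l)} (s≤s (s≤s z≤n))))
    (ℕₚ.*-zeroʳ (suc (suc l)))
  absorption (suc k) (suc l) = begin
    suc (suc l) * (suc (suc k) C suc (suc l))
      ≡⟨ cong (suc (suc l) *_) (sym (nCk+nC[k+1]≡[n+1]C[k+1] (suc k) (suc l))) ⟩
    suc (suc l) * (a + suc k C suc (suc l))
      ≡⟨ ℕₚ.*-distribˡ-+ (suc (suc l)) a _ ⟩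
    a + suc l * a + suc (suc l) * (suc k C suc (suc l))
      ≡⟨ cong₂ (λ x y → a + x + y) (absorption k l) (absorption k (suc l)) ⟩
    a + suc k * (k C l) + suc k * (k C suc l)
      ≡⟨ ℕₚ.+-assoc a _ _ ⟩
    a + (suc k * (k C l) + suc k * (k C suc l))
      ≡⟨ cong (_+_ a) (trans (sym (ℕₚ.*-distribˡ-+ (suc k) (k C l) _))
          (cong (suc k *_) (nCk+nC[k+1]≡[n+1]C[k+1] k l))) ⟩
    suc (suc k) * a ∎
    where
    open ≡-Reasoning
    a = suc k C suc l

  module Congruence (q : ℕ) (prime : Prime (suc q)) where

    p : ℕ
    p = suc q

    infix 4 _≋_
    record _≋_ (a b : ℕ) : Set where
      constructor mk
      field un : a % p ≡ b % p
    open _≋_ public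

    ≋-refl : ∀ {a} → a ≋ a
    ≋-refl = mk refl

    ≋-reflexive : ∀ {a b} → a ≡ b → a ≋ b
    ≋-reflexive refl = ≋-refl

    ≋-sym : ∀ {a b} → a ≋ b → b ≋ a
    ≋-sym (mk eq) = mk (sym eq)

    ≋-trans : ∀ {a b c} → a ≋ b → b ≋ c → a ≋ c
    ≋-trans (mk eq) (mk eq′) = mk (trans eq eq′)

    +-≋ : ∀ {a b c d} → a ≋ b → c ≋ d → a + c ≋ b + d
    +-≋ {a} {b} {c} {d} (mk eq) (mk eq′) = mk (trans (DM.%-distribˡ-+ a c p)
      (trans (cong₂ (λ x y → (x + y) % p) eq eq′) (sym (DM.%-distribˡ-+ b d p))))

    *-≋ : ∀ {a b c d} → a ≋ b → c ≋ d → a * c ≋ b * d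
    *-≋ {a} {b} {c} {d} (mk eq) (mk eq′) = mk (trans (DM.%-distribˡ-* a c p)
      (trans (cong₂ (λ x y → (x * y) % p) eq eq′) (sym (DM.%-distribˡ-* b d p))))

    %-≋ : ∀ a → a % p ≋ a
    %-≋ a = mk (DM.m%n%n≡m%n a p)

    p*≋0 : ∀ a → p * a ≋ 0
    p*≋0 a = mk (trans (cong (_% p) (ℕₚ.*-comm p a)) (DM.m*n%n≡0 a p))

    ≋0⇒∣ : ∀ {a} → a ≋ 0 → p ∣ a
    ≋0⇒∣ {a} (mk eq) = Div.m%n≡0⇒n∣m a p eq

    ∣⇒≋0 : ∀ {a} → p ∣ a → a ≋ 0
    ∣⇒≋0 {a} p∣a = mk (Div.n∣m⇒m%n≡0 a p p∣a)

    ≋⇒≡ : ∀ {a b} → a < p → b < p → a ≋ b → a ≡ b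
    ≋⇒≡ a<p b<p (mk eq) = trans (sym (DM.m<n⇒m%n≡m a<p)) (trans eq (DM.m<n⇒m%n≡m b<p))

    positive≉0 : ∀ {a} → suc a < p → ¬ suc a ≋ 0
    positive≉0 a<p a≋0 with ≋⇒≡ a<p (s≤s z≤n) a≋0
    ... | ()

    a+q*a : ∀ a → a + q * a ≋ 0
    a+q*a a = p*≋0 a

    +-cancelʳ-≋ : ∀ a b c → a + c ≋ b + c → a ≋ b
    +-cancelʳ-≋ a b c eq = ≋-trans (≋-sym (drop a)) (≋-trans (+-≋ eq (≋-refl {q * c})) (drop b))
      where
      drop : ∀ x → x + c + q * c ≋ x
      drop x = ≋-trans (≋-reflexive (ℕₚ.+-assoc x c (q * c)))
        (≋-trans (+-≋ ≋-refl (a+q*a c)) (≋-reflexive (ℕₚ.+-identityʳ x)))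

    ≋0-* : ∀ a b → a * b ≋ 0 → a ≋ 0 ⊎ b ≋ 0
    ≋0-* a b eq with euclidsLemma a b prime (≋0⇒∣ eq)
    ... | inj₁ p∣a = inj₁ (∣⇒≋0 p∣a)
    ... | inj₂ p∣b = inj₂ (∣⇒≋0 p∣b)

    *-cancelˡ-≋ : ∀ c a b → ¬ c ≋ 0 → c * a ≋ c * b → a ≋ b
    *-cancelˡ-≋ c a b c≉0 eq with ≋0-* c (a + q * b)
      (≋-trans (≋-reflexive (expand c a b q)) (≋-trans (+-≋ eq ≋-refl) (a+q*a (c * b))))
      where
      expand : ∀ c a b q → c * (a + q * b) ≡ c * a + q * (c * b)
      expand = ℕ-Ring.solve-∀
    ... | inj₁ c≋0 = contradiction c≋0 c≉0
    ... | inj₂ a+qb≋0 = ≋-trans (≋-sym (≋-trans (+-≋ (≋-refl {a}) (a+q*a b)) (≋-reflexive (ℕₚ.+-identityʳ a))))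
      (≋-trans (≋-reflexive (rearrange a b q)) (+-≋ a+qb≋0 ≋-refl))
      where
      rearrange : ∀ a b q → a + (b + q * b) ≡ a + q * b + b
      rearrange = ℕ-Ring.solve-∀

    choose≉0 : ∀ {k l} → l ≤ k → k < p → ¬ k C l ≋ 0
    choose≉0 {k} {zero} _ _ eq = positive≉0 (ℕ.nonTrivial⇒n>1 p {{prime⇒nonTrivial prime}}) eq
    choose≉0 {suc k} {suc l} (s≤s l≤k) k<p eq with ≋0-* (suc k) (k C l)
      (≋-trans (≋-reflexive (sym (absorption k l)))
          (≋-trans (*-≋ (≋-refl {suc l}) eq) (≋-reflexive (ℕₚ.*-zeroʳ (suc l)))))
    ... | inj₁ 1+k≋0 = positive≉0 k<p 1+k≋0
    ... | inj₂ eq′ = choose≉0 l≤k (ℕₚ.<-trans (ℕₚ.n<1+n k) k<p) eq′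

    pCl≋0 : ∀ {l} → suc l < p → p C suc l ≋ 0
    pCl≋0 {l} l<p with ≋0-* (suc l) (p C suc l) (≋-trans (≋-reflexive (absorption q l)) (p*≋0 (q C l)))
    ... | inj₁ 1+l≋0 = contradiction 1+l≋0 (positive≉0 l<p)
    ... | inj₂ eq = eq

    pascal : ∀ n k → suc n C suc k ≋ n C k + n C suc k
    pascal n k = ≋-reflexive (sym (nCk+nC[k+1]≡[n+1]C[k+1] n k))

    lucas : ∀ i {k} j {l} → k < p → l < p → (k + i * p) C (l + j * p) ≋ (i C j) * (k C l)
    lucas zero {zero} zero {zero} _ _ = ≋-refl
    lucas zero {zero} (suc j) {zero} _ _ = ≋-refl
    lucas zero {zero} j {suc l} _ _ = ≋-reflexive (sym (ℕₚ.*-zeroʳ (zero C j)))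
    lucas i {suc k} zero {zero} _ _ = ≋-refl
    lucas i {suc k} j {suc l} k<p l<p = ≋-trans (pascal (k + i * p) (l + j * p))
      (≋-trans (+-≋ (lucas i {k} j {l} (ℕₚ.<⇒≤ k<p) (ℕₚ.<⇒≤ l<p)) (lucas i {k} j {suc l} (ℕₚ.<⇒≤ k<p) l<p))
        (≋-trans (≋-reflexive (sym (ℕₚ.*-distribˡ-+ (i C j) (k C l) (k C suc l))))
          (*-≋ (≋-refl {i C j}) (≋-sym (pascal k l)))))
    lucas i {suc k} (suc j) {zero} k<p _ = ≋-trans (pascal (k + i * p) (q + j * p))
      (≋-trans (+-≋ (lucas i {k} j {q} (ℕₚ.<⇒≤ k<p) ℕₚ.≤-refl) (lucas i {k} (suc j) {zero} (ℕₚ.<⇒≤ k<p) (s≤s z≤n)))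
        (≋-reflexive (trans (cong (λ x → (i C j) * x + (i C suc j) * 1) (k>n⇒nCk≡0 (ℕₚ.≤-pred k<p)))
          (cong (_+ (i C suc j) * 1) (ℕₚ.*-zeroʳ (i C j))))))
    lucas (suc i) {zero} zero {zero} _ _ = ≋-refl
    lucas (suc i) {zero} (suc j) {zero} _ _ = ≋-trans (pascal (q + i * p) (q + j * p))
      (≋-trans (+-≋ (lucas i {q} j {q} ℕₚ.≤-refl ℕₚ.≤-refl) (lucas i {q} (suc j) {zero} ℕₚ.≤-refl (s≤s z≤n)))
        (≋-trans (≋-reflexive (trans (cong₂ _+_ (trans (cong ((i C j) *_) (nCn≡1 q)) (ℕₚ.*-identityʳ (i C j)))
            (ℕₚ.*-identityʳ (i C suc j)))
          (nCk+nC[k+1]≡[n+1]C[k+1] i j))) (≋-reflexive (sym (ℕₚ.*-identityʳ (suc i C suc j))))))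
    lucas (suc i) {zero} j {suc l} _ l<p = ≋-trans (pascal (q + i * p) (l + j * p))
      (≋-trans (+-≋ (lucas i {q} j {l} ℕₚ.≤-refl (ℕₚ.<⇒≤ l<p)) (lucas i {q} j {suc l} ℕₚ.≤-refl l<p))
        (≋-trans (≋-reflexive (sym (ℕₚ.*-distribˡ-+ (i C j) (q C l) (q C suc l))))
          (≋-trans (*-≋ (≋-refl {i C j}) (≋-trans (≋-sym (pascal q l)) (pCl≋0 l<p)))
            (≋-reflexive (trans (ℕₚ.*-zeroʳ (i C j)) (sym (ℕₚ.*-zeroʳ (suc i C j))))))))

    digits : ∀ m → m ≡ m % p + m / p * p
    digits m = DM.m≡m%n+[m/n]*n m p

    lucas′ : ∀ i j → i C j ≋ ((i / p) C (j / p)) * ((i % p) C (j % p))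
    lucas′ i j = ≋-trans (≋-reflexive (cong₂ _C_ (digits i) (digits j)))
      (lucas (i / p) (j / p) (DM.m%n<n i p) (DM.m%n<n j p))

    shift-digits : ∀ r i → p * r + i ≡ i % p + (r + i / p) * p
    shift-digits r i = trans (cong (_+_ (p * r)) (digits i)) (lemma r (i % p) (i / p) p)
      where
      lemma : ∀ r a b p → p * r + (a + b * p) ≡ a + (r + b) * p
      lemma = ℕ-Ring.solve-∀

    -- In (1 + x^(p^N)) (1 + x)^i the two copies of row i do not overlap.
    right-copy : ∀ N {i} x → i < p ^ N → (p ^ N + i) C (p ^ N + x) ≋ i C x
    right-copy zero {zero} zero _ = ≋-refl
    right-copy zero {zero} (suc x) _ = ≋-refl
    right-copy zero {suc i} x (s≤s ())
    right-copy (suc N) {i} x i<p^N = ≋-trans (≋-reflexive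
        (cong₂ _C_ (shift-digits (p ^ N) i) (shift-digits (p ^ N) x)))
      (≋-trans (lucas (p ^ N + i / p) (p ^ N + x / p) (DM.m%n<n i p) (DM.m%n<n x p))
        (≋-trans (*-≋ (right-copy N (x / p) (DM.m<n*o⇒m/o<n (subst (i <_) (ℕₚ.*-comm p (p ^ N)) i<p^N))) ≋-refl)
          (≋-sym (lucas′ i x))))

    left-copy : ∀ N i {x} → x < p ^ N → (p ^ N + i) C x ≋ i C x
    left-copy zero i {zero} _ = ≋-refl
    left-copy zero i {suc x} (s≤s ())
    left-copy (suc N) i {x} x<p^N = ≋-trans (≋-reflexive (cong₂ _C_ (shift-digits (p ^ N) i) (digits x)))
      (≋-trans (lucas (p ^ N + i / p) (x / p) (DM.m%n<n i p) (DM.m%n<n x p))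
        (≋-trans (*-≋ (left-copy N (i / p) (DM.m<n*o⇒m/o<n (subst (x <_) (ℕₚ.*-comm p (p ^ N)) x<p^N))) ≋-refl)
          (≋-sym (lucas′ i x))))

-- Windows into the rows

module _ where
  open import Data.Nat using (_+_; _*_)

  module Windows (q : ℕ) (prime : Prime (suc q)) where
    open Congruence q prime

    1<p : 1 < p
    1<p = ℕ.nonTrivial⇒n>1 p {{prime⇒nonTrivial prime}}

    G : ℕ → ℕ → ℕ
    G i j = (i C j) % p

    G<p : ∀ i j → G i j < p
    G<p i j = DM.m%n<n (i C j) p

    window : ℕ → ℕ → ℕ → List ℕ
    window i j n = applyUpTo (λ t → G i (j + t)) n

    Window : ℕ → List ℕ → Set
    Window n w = ∃₂ λ i j → w ≡ window i j n

    row-onePlusX : ∀ i → row p onePlusX i ≡ applyUpTo (G i) (suc i)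
    row-onePlusX i = trans (cong (map (_%ℕ p)) (polyPow-onePlusX i)) (map-applyUpTo (λ j → + (i C j)) (_%ℕ p) (suc i))

    accessible⇒window : ∀ {n w} → Accessible p onePlusX n w → Window n w
    accessible⇒window {n} {w} ((refl , _) , i , substring) =
      let (j , eq) = substring-applyUpTo⁻ (G i) (suc i) (subst (Substring w) (row-onePlusX i) substring)
      in i , j , eq

    window⇒accessible : ∀ {n w} → Window n w → Accessible p onePlusX n w
    window⇒accessible {n} (i , j , refl) =
      (length-applyUpTo _ n , Allₚ.applyUpTo⁺₂ _ n (λ t → G<p i (j + t))) , P + i ,
      subst₂ Substring (applyUpTo-cong n (λ t t<n → un
          (left-copy N i (ℕₚ.<-trans (ℕₚ.+-monoʳ-< j t<n) (n<m^n 1<p N)))))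
        (sym (row-onePlusX (P + i)))
        (substring-applyUpTo⁺ (G (P + i)) j n
            (ℕₚ.≤-trans (ℕₚ.<⇒≤ (n<m^n 1<p N)) (ℕₚ.≤-trans (ℕₚ.m≤m+n P i) (ℕₚ.n≤1+n _))))
      where
      N = j + n
      P = p ^ N

    window-beyond : ∀ m i j n → ∃₂ λ i′ j′ → m ≤ j′ × window i j n ≡ window i′ j′ n
    window-beyond m i j n = P + i , P + j ,
      ℕₚ.≤-trans (ℕₚ.m≤n+m m i) (ℕₚ.≤-trans (ℕₚ.<⇒≤ (n<m^n 1<p N)) (ℕₚ.m≤m+n P j)) ,
      applyUpTo-cong n (λ t _ → sym (un (≋-trans (≋-reflexive (cong ((P + i) C_) (ℕₚ.+-assoc P j t)))
        (right-copy N (j + t) (ℕₚ.≤-<-trans (ℕₚ.m≤m+n i m) (n<m^n 1<p N))))))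
      where
      N = i + m
      P = p ^ N

    scaled-copy : ∀ N a {i x} → i < p ^ N → x < p ^ N → (a * p ^ N + i) C (p ^ N + x) ≋ a * (i C x)
    scaled-copy zero a {zero} {zero} _ _ = ≋-reflexive (trans (cong (_C 1) (trans (ℕₚ.+-identityʳ (a * 1)) (ℕₚ.*-identityʳ a))) (trans (nC1≡n a) (sym (ℕₚ.*-identityʳ a))))
    scaled-copy zero a {suc i} (s≤s ()) _
    scaled-copy zero a {zero} {suc x} _ (s≤s ())
    scaled-copy (suc N) a {i} {x} i<P x<P =
      ≋-trans (≋-reflexive (cong₂ _C_ (trans (cong (_+ i) (lemma a p (p ^ N))) (shift-digits (a * p ^ N) i))
          (shift-digits (p ^ N) x)))
      (≋-trans (lucas (a * p ^ N + i / p) (p ^ N + x / p) (DM.m%n<n i p) (DM.m%n<n x p))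
      (≋-trans (*-≋ (scaled-copy N a (shrink i<P) (shrink x<P)) ≋-refl)
      (≋-trans (≋-reflexive (ℕₚ.*-assoc a ((i / p) C (x / p)) ((i % p) C (x % p))))
          (*-≋ (≋-refl {a}) (≋-sym (lucas′ i x))))))
      where
      lemma : ∀ a p r → a * (p * r) ≡ p * (a * r)
      lemma = ℕ-Ring.solve-∀
      shrink : ∀ {y} → y < p ^ suc N → y / p < p ^ N
      shrink {y} y<P = DM.m<n*o⇒m/o<n (subst (y <_) (ℕₚ.*-comm p (p ^ N)) y<P)

    scale : ∀ a i j n → ∃₂ λ i′ j′ → window (i + i′ * p) (j + j′ * p) n ≡ applyUpTo (λ t → (a * G i (j + t)) % p) n
    scale a i j n = a * p ^ N , p ^ N , applyUpTo-cong n λ t t<n → un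
      (≋-trans (≋-reflexive (cong₂ _C_ (lemma₁ i a (p ^ N) p) (lemma₂ j (p ^ N) p t)))
      (≋-trans (scaled-copy (suc N) a {i} {j + t}
          (ℕₚ.≤-<-trans (ℕₚ.m≤m+n i (j + n)) N<P)
              (ℕₚ.<-≤-trans (ℕₚ.+-monoʳ-< j t<n) (ℕₚ.≤-trans (ℕₚ.m≤n+m (j + n) i) (ℕₚ.<⇒≤ N<P))))
        (*-≋ (≋-refl {a}) (≋-sym (%-≋ (i C (j + t)))))))
      where
      N = i + (j + n)
      N<P : N < p ^ suc N
      N<P = ℕₚ.<-trans (ℕₚ.n<1+n N) (n<m^n 1<p (suc N))
      lemma₁ : ∀ i a P p → i + a * P * p ≡ a * (p * P) + i
      lemma₁ = ℕ-Ring.solve-∀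
      lemma₂ : ∀ j P p t → j + P * p + t ≡ p * P + (j + t)
      lemma₂ = ℕ-Ring.solve-∀

    scaled-entry : ∀ a i j {x} → x < p → a * (i C j) ≋ x → (a * G i j) % p ≡ x
    scaled-entry a i j x<p eq = ≋⇒≡ (DM.m%n<n (a * G i j) p) x<p
      (≋-trans (%-≋ (a * G i j)) (≋-trans (*-≋ (≋-refl {a}) (%-≋ (i C j))) eq))

    quotient : ∀ c d → ¬ c ≋ 0 → ∃ λ x → x < p × c * x ≋ d
    quotient c d c≉0 with c % p in eq
    ... | zero = contradiction (mk eq) c≉0
    ... | suc b with coprime-Bézout (prime⇒coprime prime (subst (_< p) eq (DM.m%n<n c p)))
    ...   | Bézout.+- x y eq′ = (q * y * d) % p , DM.m%n<n (q * y * d) p ,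
      ≋-trans (*-≋ c≋ (%-≋ (q * y * d))) (+-cancelʳ-≋ _ d (q * d)
        (≋-trans (≋-reflexive (trans (lemma (suc b) q y d) (cong (λ z → q * d * z) eq′)))
          (≋-trans (≋-trans (≋-reflexive (lemma′ (q * d) x p)) (p*≋0 _)) (≋-sym (a+q*a d)))))
      where
      c≋ : c ≋ suc b
      c≋ = ≋-trans (≋-sym (%-≋ c)) (≋-reflexive eq)
      lemma : ∀ c q y d → c * (q * y * d) + q * d ≡ q * d * (1 + y * c)
      lemma = ℕ-Ring.solve-∀
      lemma′ : ∀ a x p → a * (x * p) ≡ p * (a * x)
      lemma′ = ℕ-Ring.solve-∀
    ...   | Bézout.-+ x y eq′ = (y * d) % p , DM.m%n<n (y * d) p ,
      ≋-trans (*-≋ c≋ (%-≋ (y * d))) (≋-trans (≋-reflexive (trans (lemma (suc b) y d) (cong (d *_) (sym eq′))))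
        (≋-trans (≋-reflexive (lemma′ d x p))
            (≋-trans (+-≋ (≋-refl {d}) (p*≋0 (d * x))) (≋-reflexive (ℕₚ.+-identityʳ d)))))
      where
      c≋ : c ≋ suc b
      c≋ = ≋-trans (≋-sym (%-≋ c)) (≋-reflexive eq)
      lemma : ∀ c y d → c * (y * d) ≡ d * (y * c)
      lemma = ℕ-Ring.solve-∀
      lemma′ : ∀ d x p → d * (1 + x * p) ≡ d + p * (d * x)
      lemma′ = ℕ-Ring.solve-∀

    at : List ℕ → ℕ → ℕ
    at [] _ = 0
    at (x ∷ _) zero = x
    at (_ ∷ xs) (suc t) = at xs t

    at-applyUpTo : ∀ (f : ℕ → ℕ) n {t} → t < n → at (applyUpTo f n) t ≡ f t
    at-applyUpTo f (suc n) {zero} _ = refl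
    at-applyUpTo f (suc n) {suc t} (s≤s t<n) = at-applyUpTo (f ∘ suc) n t<n

    -- The 0 stands for the entry of row i before u, whose only visible columns lie beyond k and vanish.
    entry : ℕ → ℕ → List ℕ → ℕ → ℕ
    entry k s u t = (at (0 ∷ u) ((suc t + k + s) / p) * (k C ((suc t + k + s) % p))) % p

    expand : ℕ → ℕ → ℕ → List ℕ → List ℕ
    expand k s n u = applyUpTo (entry k s u) n

    cells : ℕ → ℕ → ℕ → ℕ
    cells n k s = (n + k + s) / p

    record Expansion (n k s : ℕ) (w : List ℕ) : Set where
      constructor expansion
      field
        row-quotient column-quotient : ℕ
        is-window : w ≡ window (k + row-quotient * p) (suc k + s + column-quotient * p) n

    expand-window : ∀ {k} s n i j → k < p →
      expand k s n (window i (suc j) (cells n k s)) ≡ window (k + i * p) (suc k + s + j * p) n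
    expand-window {k} s n i j k<p = applyUpTo-cong n λ t t<n → un (step t t<n)
      where
      V = cells n k s
      lemma : ∀ k s j p t → suc k + s + j * p + t ≡ suc t + k + s + j * p
      lemma = ℕ-Ring.solve-∀
      regroup : ∀ l c j p → l + c * p + j * p ≡ l + (c + j) * p
      regroup = ℕ-Ring.solve-∀
      step : ∀ t → t < n → at (0 ∷ window i (suc j) V) ((suc t + k + s) / p) * (k C ((suc t + k + s) % p))
        ≋ (k + i * p) C (suc k + s + j * p + t)
      step t t<n = ≋-trans main (≋-sym (≋-trans (≋-reflexive (cong ((k + i * p) C_)
          (trans (lemma k s j p t) (trans (cong (_+ j * p) (digits y)) (regroup (y % p) (y / p) j p)))))
        (lucas i (y / p + j) k<p (DM.m%n<n y p))))
        where
        y = suc t + k + s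
        y/p≤V : y / p ≤ V
        y/p≤V = DM./-monoˡ-≤ p (ℕₚ.+-monoˡ-≤ s (ℕₚ.+-monoˡ-≤ k t<n))
        k<y : k < y
        k<y = s≤s (ℕₚ.≤-trans (ℕₚ.m≤n+m k t) (ℕₚ.m≤m+n (t + k) s))
        main : at (0 ∷ window i (suc j) V) (y / p) * (k C (y % p)) ≋ (i C (y / p + j)) * (k C (y % p))
        main with y / p in eq | y/p≤V
        ... | zero | _ = ≋-reflexive (trans (cong (0 *_) kCy≡0)
            (sym (trans (cong ((i C j) *_) kCy≡0) (ℕₚ.*-zeroʳ (i C j)))))
          where
          kCy≡0 : k C (y % p) ≡ 0
          kCy≡0 = k>n⇒nCk≡0 (subst (k <_) (sym (DM.m<n⇒m%n≡m (DM.m/n≡0⇒m<n {y} {p} eq))) k<y)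
        ... | suc c | c<V = *-≋ (≋-trans (≋-reflexive (at-applyUpTo (λ t → G i (suc j + t)) V c<V))
          (≋-trans (%-≋ _) (≋-reflexive (cong (λ x → i C suc x) (ℕₚ.+-comm j c))))) ≋-refl

    expansion⇒window : ∀ {n k s w} → Expansion n k s w → Window n w
    expansion⇒window {k = k} {s} (expansion i j eq) = k + i * p , suc k + s + j * p , eq

    window⇒expansion : ∀ {n w} → Window n w → ∃₂ λ k s → k < p × s < p × Expansion n k s w
    window⇒expansion {n} (i , j , refl) with window-beyond p i j n
    ... | i′ , j′ , p≤j′ , eq = k , r % p , k<p , DM.m%n<n r p , expansion (i′ / p) (r / p)
      (trans eq (cong₂ (λ x y → window x y n) (digits i′)
        (sym (trans (ℕₚ.+-assoc (suc k) (r % p) (r / p * p))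
          (trans (cong (_+_ (suc k)) (sym (digits r))) (ℕₚ.m+[n∸m]≡n (ℕₚ.≤-trans k<p p≤j′)))))))
      where
      k = i′ % p
      k<p = DM.m%n<n i′ p
      r = j′ ∸ suc k

    expand⇒expansion : ∀ {n k s} → k < p → ∀ {w} →
        (∃ λ u → Window (cells n k s) u × w ≡ expand k s n u) → Expansion n k s w
    expand⇒expansion {n} {k} {s} k<p (_ , (i , j , refl) , refl) with window-beyond 1 i j (cells n k s)
    ... | i′ , suc j′ , _ , eq = expansion i′ j′ (trans (cong (expand k s n) eq) (expand-window s n i′ j′ k<p))

    expansion⇒expand : ∀ {n k s} → k < p → ∀ {w} → Expansion n k s w → ∃ λ u → Window
        (cells n k s) u × w ≡ expand k s n u
    expansion⇒expand {n} {k} {s} k<p (expansion i j refl) = _ , (i , suc j , refl) , sym (expand-window s n i j k<p)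

    visible : ∀ {n k s c} → 0 < n → s < p → c < cells n k s →
      ∃₂ λ t l → t < n × l ≤ k × suc t + k + s ≡ l + suc c * p
    visible {n} {k} {s} {c} 0<n s<p c<V with suc (k + s) ℕ.≤? suc c * p
    ... | yes le = suc c * p ∸ suc (k + s) , 0 , ℕₚ.+-cancelʳ-≤ (k + s) _ n
        (subst₂ _≤_ (trans (sym eq) (ℕₚ.+-assoc _ k s)) (ℕₚ.+-assoc n k s)
          (ℕₚ.≤-trans (ℕₚ.*-monoˡ-≤ p c<V) (DM.m/n*n≤m (n + k + s) p))) , z≤n , eq
      where
      eq : suc (suc c * p ∸ suc (k + s)) + k + s ≡ suc c * p
      eq = trans (ℕₚ.+-assoc _ k s) (trans (sym (ℕₚ.+-suc _ (k + s))) (ℕₚ.m∸n+n≡m le))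
    ... | no ≰ = 0 , suc (k + s) ∸ suc c * p , 0<n ,
      ℕₚ.m≤n+o⇒m∸n≤o (suc (k + s)) (suc c * p)
          (ℕₚ.≤-trans (subst (_≤ p + k) (trans (ℕₚ.+-comm (suc s) k) (ℕₚ.+-suc k s)) (ℕₚ.+-monoˡ-≤ k s<p))
        (ℕₚ.+-monoˡ-≤ k (ℕₚ.m≤m+n p (c * p)))) ,
      sym (ℕₚ.m∸n+n≡m (ℕₚ.<⇒≤ (ℕₚ.≰⇒> ≰)))

    expand-injective : ∀ {n k s} → 0 < n → k < p → s < p → ∀ {u u′} → Window (cells n k s) u → Window
        (cells n k s) u′ →
      expand k s n u ≡ expand k s n u′ → u ≡ u′
    expand-injective {n} {k} {s} 0<n k<p s<p {u} {u′} (i , j , refl) (i′ , j′ , refl) eq =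
      applyUpTo-cong (cells n k s) λ c c<V →
        let (t , l , t<n , l≤k , y≡) = visible 0<n s<p c<V
            l<p = ℕₚ.≤-<-trans l≤k k<p
            quot : (suc t + k + s) / p ≡ suc c
            quot = trans (cong (_/ p) y≡) (trans (DM.+-distrib-/-∣ʳ l (Div.n∣m*n (suc c)))
              (cong₂ _+_ (DM.m<n⇒m/n≡0 l<p) (DM.m*n/n≡m (suc c) p)))
            rem : (suc t + k + s) % p ≡ l
            rem = trans (cong (_% p) y≡) (trans (DM.[m+kn]%n≡m%n l (suc c) p) (DM.m<n⇒m%n≡m l<p))
            value = λ i j → trans (cong₂ (λ x z → (at (0 ∷ window i j (cells n k s)) x * (k C z)) % p) quot rem)
              (cong (λ x → (x * (k C l)) % p) (at-applyUpTo (λ t → G i (j + t)) (cells n k s) c<V))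
        in ≋⇒≡ (G<p i (j + c)) (G<p i′ (j′ + c)) (*-cancelˡ-≋ (k C l) _ _ (choose≉0 l≤k k<p)
          (mk (trans (cong (_% p) (ℕₚ.*-comm (k C l) _))
              (trans (sym (value i j)) (trans
                  (applyUpTo-injective (entry k s (window i j (cells n k s)))
                      (entry k s (window i′ j′ (cells n k s))) n eq t<n)
            (trans (value i′ j′) (cong (_% p) (ℕₚ.*-comm _ (k C l)))))))))

    card-expansion : ∀ {n k s z} → 0 < n → k < p → s < p → Card (Window (cells n k s)) z → Card (Expansion n k s) z
    card-expansion {n} {k} {s} 0<n k<p s<p c = card-resp (expand⇒expansion k<p) (expansion⇒expand k<p)
      (card-image (expand k s n) (expand-injective 0<n k<p s<p) c)

  module Collisions (q : ℕ) (prime : Prime (suc q)) (m : ℕ) where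
    open Congruence q prime
    open Windows q prime

    n : ℕ
    n = suc (suc (suc m))

    *-cancelʳ-≋ : ∀ {a b} c → ¬ c ≋ 0 → a * c ≋ b * c → a ≋ b
    *-cancelʳ-≋ {a} {b} c c≉0 eq = *-cancelˡ-≋ c a b c≉0
      (subst₂ _≋_ (ℕₚ.*-comm a c) (ℕₚ.*-comm b c) eq)

    suc-cancel-≋ : ∀ {a b} → suc a ≋ suc b → a ≋ b
    suc-cancel-≋ {a} {b} eq = +-cancelʳ-≋ a b 1 (subst₂ _≋_ (ℕₚ.+-comm 1 a) (ℕₚ.+-comm 1 b) eq)

    suc-≋0 : ∀ {a} → a < p → suc a ≋ 0 → a ≡ q
    suc-≋0 a<p eq with ℕₚ.m≤n⇒m<n∨m≡n a<p
    ... | inj₁ 1+a<p = contradiction eq (positive≉0 1+a<p)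
    ... | inj₂ refl = refl

    -- The absorption identity (j+1) C(I+1,j+1) = (I+1) C(I,j) for the entries of row I from column J on.
    record Recurrent (I J : ℕ) (f : ℕ → ℕ) : Set where
      constructor recurrent
      field recurrence : ∀ {t} → suc t < n → suc (J + t) * (f t + f (suc t)) ≋ suc I * f t
    open Recurrent

    recurrent-window : ∀ {I J} {f : ℕ → ℕ} → applyUpTo f n ≡ window I J n → Recurrent I J f
    recurrent-window {I} {J} {f} eq = recurrent go
      where
      go : ∀ {t} → suc t < n → suc (J + t) * (f t + f (suc t)) ≋ suc I * f t
      go {t} 1+t<n =
        ≋-trans (*-≋ (≋-refl {suc (J + t)}) (+-≋ f₀ f₁))
        (≋-trans (≋-reflexive (trans (cong (λ x → suc (J + t) * (I C (J + t) + I C x)) (ℕₚ.+-suc J t))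
          (trans (cong (suc (J + t) *_) (nCk+nC[k+1]≡[n+1]C[k+1] I (J + t))) (absorption I (J + t)))))
          (*-≋ (≋-refl {suc I}) (≋-sym f₀)))
        where
        f₀ : f t ≋ I C (J + t)
        f₀ = ≋-trans (≋-reflexive (applyUpTo-injective f (λ t → G I (J + t)) n eq (ℕₚ.<-trans (ℕₚ.n<1+n t) 1+t<n)))
          (%-≋ (I C (J + t)))
        f₁ : f (suc t) ≋ I C (J + suc t)
        f₁ = ≋-trans (≋-reflexive (applyUpTo-injective f (λ t → G I (J + t)) n eq 1+t<n)) (%-≋ (I C (J + suc t)))

    recurrent-resp : ∀ {I I′ J J′ f} → I ≋ I′ → J ≋ J′ → Recurrent I J f → Recurrent I′ J′ f
    recurrent-resp {f = f} I≋ J≋ rec = recurrent λ {t} lt → ≋-trans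
        (*-≋ (≋-sym (+-≋ (≋-refl {1}) (+-≋ J≋ (≋-refl {t})))) ≋-refl)
      (≋-trans (recurrence rec lt) (*-≋ (+-≋ (≋-refl {1}) I≋) ≋-refl))

    module _ {I J : ℕ} {f : ℕ → ℕ} (rec : Recurrent I J f) where

      row-end : ∀ {t} → suc t < n → ¬ f t ≋ 0 → f (suc t) ≋ 0 → J + t ≋ I
      row-end {t} lt x≉0 y≋0 = suc-cancel-≋ (*-cancelʳ-≋ (f t) x≉0
        (≋-trans (*-≋ (≋-refl {suc (J + t)}) (≋-trans (≋-reflexive (sym (ℕₚ.+-identityʳ (f t))))
            (+-≋ (≋-refl {f t}) (≋-sym y≋0)))) (recurrence rec lt)))

      row-start : ∀ {t} → suc t < n → f t ≋ 0 → ¬ f (suc t) ≋ 0 → suc (J + t) ≋ 0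
      row-start {t} lt x≋0 y≉0 = *-cancelʳ-≋ (f (suc t)) y≉0
        (≋-trans (*-≋ (≋-refl {suc (J + t)}) (+-≋ (≋-sym x≋0) (≋-refl {f (suc t)})))
          (≋-trans (recurrence rec lt) (≋-trans (*-≋ (≋-refl {suc I}) x≋0) (≋-reflexive (ℕₚ.*-zeroʳ (suc I))))))

      ratio-at-end : ∀ {t} → suc (suc t) < n → ¬ f (suc t) ≋ 0 → f (suc (suc t)) ≋ 0 → I * f (suc t) ≋ f t
      ratio-at-end {t} lt y≉0 z≋0 = +-cancelʳ-≋ _ _ (I * f t)
        (≋-trans (≋-reflexive (lemma I (f t) (f (suc t))))
          (≋-trans (*-≋ (≋-sym (≋-trans (≋-reflexive (sym (ℕₚ.+-suc J t))) (row-end lt y≉0 z≋0))) ≋-refl)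
            (recurrence rec (ℕₚ.<-trans (ℕₚ.n<1+n _) lt))))
        where
        lemma : ∀ i x y → i * y + i * x ≡ i * (x + y)
        lemma = ℕ-Ring.solve-∀

      ratio-at-start : ∀ {t} → suc (suc t) < n → f t ≋ 0 → ¬ f (suc t) ≋ 0 → f (suc (suc t)) ≋ I * f (suc t)
      ratio-at-start {t} lt x≋0 y≉0 = +-cancelʳ-≋ _ _ y
        (≋-trans (≋-reflexive (lemma y (f (suc (suc t)))))
          (≋-trans (*-≋ (+-≋ (≋-refl {1}) (≋-sym
              (≋-trans (≋-reflexive (ℕₚ.+-suc J t)) (row-start (ℕₚ.<-trans (ℕₚ.n<1+n _) lt) x≋0 y≉0)))) ≋-refl)
            (≋-trans (recurrence rec lt) (≋-reflexive (ℕₚ.+-comm y (I * y))))))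
        where
        y = f (suc t)
        lemma : ∀ y z → z + y ≡ (1 + 0) * (y + z)
        lemma = ℕ-Ring.solve-∀

      alternation : ∀ {t} → suc t < n → ¬ f t ≋ 0 → f t + f (suc t) ≋ 0 → suc I ≋ 0
      alternation {t} lt x≉0 sum≋0 = *-cancelʳ-≋ (f t) x≉0
        (≋-trans (≋-sym (recurrence rec lt)) (≋-trans (*-≋ (≋-refl {suc (J + t)}) sum≋0)
            (≋-reflexive (ℕₚ.*-zeroʳ (suc (J + t))))))

      no-alternation : ∀ {t} → suc t < n → suc I ≋ 0 → ¬ f t + f (suc t) ≋ 0 → suc (J + t) ≋ 0
      no-alternation {t} lt I≋ sum≉0 = *-cancelʳ-≋ (f t + f (suc t)) sum≉0
        (≋-trans (recurrence rec lt) (*-≋ I≋ ≋-refl))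

      column-ratio : suc J * ((f 0 + f 1) * f 1) ≋ suc (suc J) * ((f 1 + f 2) * f 0)
      column-ratio = ≋-trans (≋-reflexive (sym (ℕₚ.*-assoc (suc J) (f 0 + f 1) (f 1))))
        (≋-trans (*-≋ (≋-trans (≋-reflexive (cong (λ x → suc x * (f 0 + f 1)) (sym (ℕₚ.+-identityʳ J))))
            (recurrence rec (s≤s (s≤s z≤n)))) ≋-refl)
        (≋-trans (≋-reflexive (swap (suc I) (f 0) (f 1)))
        (≋-trans (*-≋ (≋-sym (≋-trans (≋-reflexive (cong (λ x → suc x * (f 1 + f 2)) (ℕₚ.+-comm 1 J)))
            (recurrence rec (s≤s (s≤s (s≤s z≤n)))))) ≋-refl)
          (≋-reflexive (ℕₚ.*-assoc (suc (suc J)) (f 1 + f 2) (f 0))))))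
        where
        swap : ∀ i x y → i * x * y ≡ i * y * x
        swap = ℕ-Ring.solve-∀

    zeros : ℕ → ℕ
    zeros _ = 0

    leftmost : ℕ → ℕ → ℕ
    leftmost a zero = a
    leftmost a (suc _) = 0

    rightmost : ℕ → ℕ → ℕ
    rightmost b t with suc t ℕ.≟ n
    ... | yes _ = b
    ... | no _ = 0

    alternating : ℕ → ℕ → ℕ
    alternating a zero = a
    alternating a (suc zero) = p ∸ a
    alternating a (suc (suc t)) = alternating a t

    rightmost-last : ∀ b → rightmost b (suc (suc m)) ≡ b
    rightmost-last b with n ℕ.≟ n
    ... | yes _ = refl
    ... | no n≢n = contradiction refl n≢n

    rightmost-early : ∀ b {t} → suc t < n → rightmost b t ≡ 0
    rightmost-early b {t} lt with suc t ℕ.≟ n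
    ... | yes eq = contradiction eq (ℕₚ.<⇒≢ lt)
    ... | no _ = refl

    Zero Left Right Alternating Degenerate : List ℕ → Set
    Zero w = w ≡ applyUpTo zeros n
    Left w = ∃ λ a → a < q × w ≡ applyUpTo (leftmost (suc a)) n
    Right w = ∃ λ b → b < q × w ≡ applyUpTo (rightmost (suc b)) n
    Alternating w = ∃ λ a → a < q × w ≡ applyUpTo (alternating (suc a)) n
    Degenerate w = Zero w ⊎ Left w ⊎ Right w ⊎ Alternating w

    alternating-sum : ∀ {a} → a ≤ p → ∀ t → alternating a t + alternating a (suc t) ≋ 0
    alternating-sum {a} a≤p zero = ≋-trans (≋-reflexive (ℕₚ.m+[n∸m]≡n a≤p)) (mk (DM.n%n≡0 p))
    alternating-sum {a} a≤p (suc zero) = ≋-trans (≋-reflexive (ℕₚ.m∸n+n≡m a≤p)) (mk (DM.n%n≡0 p))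
    alternating-sum a≤p (suc (suc t)) = alternating-sum a≤p t

    alternating-< : ∀ {a} → a < q → ∀ t → alternating (suc a) t < p
    alternating-< a<q zero = s≤s a<q
    alternating-< {a} a<q (suc zero) = s≤s (ℕₚ.m∸n≤m q a)
    alternating-< a<q (suc (suc t)) = alternating-< a<q t

    alternating-unique : ∀ {a} {g : ℕ → ℕ} → a < q → (∀ t → g t < p) → g 0 ≡ suc a →
      (∀ {t} → suc t < n → g t + g (suc t) ≋ 0) → applyUpTo g n ≡ applyUpTo (alternating (suc a)) n
    alternating-unique {a} {g} a<q g<p g0 sums = applyUpTo-cong n go
      where
      go : ∀ t → t < n → g t ≡ alternating (suc a) t
      go zero _ = g0
      go (suc t) lt = ≋⇒≡ (g<p (suc t)) (alternating-< a<q (suc t)) (+-cancelʳ-≋ _ _ (g t)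
        (≋-trans (≋-trans (≋-reflexive (ℕₚ.+-comm (g (suc t)) (g t))) (sums lt))
          (≋-trans (≋-sym (alternating-sum (s≤s (ℕₚ.<⇒≤ a<q)) t))
            (≋-reflexive (trans (ℕₚ.+-comm (alternating (suc a) t) _)
                (cong (_+_ (alternating (suc a) (suc t))) (sym (go t (ℕₚ.<-trans (ℕₚ.n<1+n t) lt)))))))))

    module _ {f : ℕ → ℕ} (f<p : ∀ t → f t < p) {I J I′ J′ : ℕ}
             (rec : Recurrent I J f) (rec′ : Recurrent I′ J′ f) where

      private
        Goal : Set
        Goal = Degenerate (applyUpTo f n) ⊎ (I ≋ I′ × J ≋ J′)

        nonzero : ∀ {t} → f t ≢ 0 → ¬ f t ≋ 0
        nonzero {t} f≢0 f≋0 = f≢0 (≋⇒≡ (f<p t) (s≤s z≤n) f≋0)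

        zero≋ : ∀ {t} → f t ≡ 0 → f t ≋ 0
        zero≋ = ≋-reflexive

        predecessor : ∀ t → f t ≢ 0 → ∃ λ a → a < q × f t ≡ suc a
        predecessor t f≢0 with f t | f<p t
        ... | zero | _ = contradiction refl f≢0
        ... | suc a | s≤s a<q = a , a<q , refl

        columns : ∀ {t x} → J + t ≋ x → J′ + t ≋ x → J ≋ J′
        columns {t} eq eq′ = +-cancelʳ-≋ J J′ t (≋-trans eq (≋-sym eq′))

        columns-at-start : ∀ {t} → suc (J + t) ≋ 0 → suc (J′ + t) ≋ 0 → J ≋ J′
        columns-at-start {t} eq eq′ = columns ≋-refl (≋-sym (suc-cancel-≋ (≋-trans eq (≋-sym eq′))))

        End Start : ℕ → Set
        End t = f t ≢ 0 × f (suc t) ≡ 0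
        Start t = f t ≡ 0 × f (suc t) ≢ 0

        end? = ℕₚ.anyUpTo? (λ t → ¬? (f t ℕ.≟ 0) ×-dec (f (suc t) ℕ.≟ 0)) (suc (suc m))
        start? = ℕₚ.anyUpTo? (λ t → (f t ℕ.≟ 0) ×-dec ¬? (f (suc t) ℕ.≟ 0)) (suc (suc m))

        module NoStart (¬start : ¬ ∃ λ t → t < suc (suc m) × Start t) where

          zero-after : ∀ {a} → f a ≡ 0 → ∀ d → a + d < n → f (a + d) ≡ 0
          zero-after {a} fa zero _ = trans (cong f (ℕₚ.+-identityʳ a)) fa
          zero-after {a} fa (suc d) lt with f (a + suc d) ℕ.≟ 0
          ... | yes eq = eq
          ... | no ≢0 = contradiction (a + d , ℕₚ.≤-pred 2+a+d≤n , zero-after fa d (ℕₚ.<⇒≤ 2+a+d≤n) ,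
                           subst (λ x → f x ≢ 0) (ℕₚ.+-suc a d) ≢0) ¬start
            where
            2+a+d≤n : suc (a + d) < n
            2+a+d≤n = subst (_< n) (ℕₚ.+-suc a d) lt

        module NoEnd (¬end : ¬ ∃ λ t → t < suc (suc m) × End t) where

          nonzero-after : ∀ {a} → f a ≢ 0 → ∀ d → a + d < n → f (a + d) ≢ 0
          nonzero-after {a} fa zero _ = subst (λ x → f x ≢ 0) (sym (ℕₚ.+-identityʳ a)) fa
          nonzero-after {a} fa (suc d) lt eq = ¬end (a + d , ℕₚ.≤-pred 2+a+d≤n , nonzero-after fa d (ℕₚ.<⇒≤ 2+a+d≤n) ,
                           trans (cong f (sym (ℕₚ.+-suc a d))) eq)
            where
            2+a+d≤n : suc (a + d) < n
            2+a+d≤n = subst (_< n) (ℕₚ.+-suc a d) lt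

        rows-at : ∀ {a} → ¬ a ≋ 0 → I * a ≋ I′ * a → I ≋ I′
        rows-at {a} a≉0 = *-cancelʳ-≋ a a≉0

      both : (∃ λ t → t < suc (suc m) × End t) → (∃ λ t → t < suc (suc m) × Start t) → Goal
      both (t , t< , x≢0 , y≡0) (t′ , t′< , x′≡0 , y′≢0) = inj₂ (rows , cols)
        where
        cols : J ≋ J′
        cols = columns-at-start (row-start rec (s≤s t′<) (zero≋ x′≡0) (nonzero y′≢0))
            (row-start rec′ (s≤s t′<) (zero≋ x′≡0) (nonzero y′≢0))
        rows : I ≋ I′
        rows = ≋-trans (≋-sym (row-end rec (s≤s t<) (nonzero x≢0) (zero≋ y≡0)))
          (≋-trans (+-≋ cols (≋-refl {t})) (row-end rec′ (s≤s t<) (nonzero x≢0) (zero≋ y≡0)))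

      end-only : (∃ λ t → t < suc (suc m) × End t) → ¬ (∃ λ t → t < suc (suc m) × Start t) → Goal
      end-only (zero , _ , x≢0 , y≡0) ¬start = inj₁ (inj₂ (inj₁ (leftWord (predecessor 0 x≢0))))
        where
        open NoStart ¬start
        leftWord : (∃ λ a → a < q × f 0 ≡ suc a) → Left (applyUpTo f n)
        leftWord (a , a<q , eq) = a , a<q , applyUpTo-cong n value
          where
          value : ∀ t → t < n → f t ≡ leftmost (suc a) t
          value zero _ = eq
          value (suc t) lt = zero-after y≡0 t lt
      end-only (suc t , t< , x≢0 , y≡0) ¬start = inj₂ (rows , cols)
        where
        open NoStart ¬start
        rows : I ≋ I′
        rows = rows-at (nonzero x≢0) (≋-trans (ratio-at-end rec (s≤s t<) (nonzero x≢0) (zero≋ y≡0))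
          (≋-sym (ratio-at-end rec′ (s≤s t<) (nonzero x≢0) (zero≋ y≡0))))
        cols : J ≋ J′
        cols = columns (≋-trans (row-end rec (s≤s t<) (nonzero x≢0) (zero≋ y≡0)) rows)
            (row-end rec′ (s≤s t<) (nonzero x≢0) (zero≋ y≡0))

      start-only : ¬ (∃ λ t → t < suc (suc m) × End t) → (∃ λ t → t < suc (suc m) × Start t) → Goal
      start-only ¬end (t , t< , x≡0 , y≢0) with ℕₚ.m≤n⇒m<n∨m≡n t<
      ... | inj₁ 1+t< = inj₂ (rows , cols)
        where
        rows : I ≋ I′
        rows = rows-at (nonzero y≢0) (≋-trans (≋-sym (ratio-at-start rec (s≤s 1+t<) (zero≋ x≡0) (nonzero y≢0)))
          (ratio-at-start rec′ (s≤s 1+t<) (zero≋ x≡0) (nonzero y≢0)))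
        cols : J ≋ J′
        cols = columns-at-start (row-start rec (s≤s t<) (zero≋ x≡0) (nonzero y≢0))
            (row-start rec′ (s≤s t<) (zero≋ x≡0) (nonzero y≢0))
      ... | inj₂ refl = inj₁ (inj₂ (inj₂ (inj₁ (rightWord (predecessor _ y≢0)))))
        where
        open NoEnd ¬end
        early : ∀ {t} → suc t < n → f t ≡ 0
        early {t} lt with f t ℕ.≟ 0
        ... | yes eq = eq
        ... | no ≢0 = contradiction x≡0 (subst (λ x → f x ≢ 0) t+d
            (nonzero-after ≢0 (suc m ∸ t) (subst (_< n) (sym t+d) (s≤s (ℕₚ.n≤1+n _)))))
          where
          t+d : t + (suc m ∸ t) ≡ suc m
          t+d = ℕₚ.m+[n∸m]≡n (ℕₚ.≤-pred (ℕₚ.≤-pred lt))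
        rightWord : (∃ λ b → b < q × f (suc (suc m)) ≡ suc b) → Right (applyUpTo f n)
        rightWord (b , b<q , eq) = b , b<q , applyUpTo-cong n value
          where
          value : ∀ t → t < n → f t ≡ rightmost (suc b) t
          value t t<n with ℕₚ.m≤n⇒m<n∨m≡n t<n
          ... | inj₁ 1+t<n = trans (early 1+t<n) (sym (rightmost-early (suc b) 1+t<n))
          ... | inj₂ refl = trans eq (sym (rightmost-last (suc b)))

      neither : ¬ (∃ λ t → t < suc (suc m) × End t) → ¬ (∃ λ t → t < suc (suc m) × Start t) → Goal
      neither ¬end ¬start with f 0 ℕ.≟ 0
      ... | yes f0≡0 = inj₁ (inj₁ (applyUpTo-cong n (NoStart.zero-after ¬start f0≡0)))
      ... | no f0≢0 with ℕₚ.anyUpTo? (λ t → ¬? ((f t + f (suc t)) % p ℕ.≟ 0)) (suc (suc m))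
      ...   | no none = inj₁ (inj₂ (inj₂ (inj₂ (alternatingWord (predecessor 0 f0≢0)))))
        where
        sums : ∀ {t} → suc t < n → f t + f (suc t) ≋ 0
        sums {t} (s≤s lt) = mk (decidable-stable (_ ℕ.≟ 0) (λ ≢0 → none (t , lt , ≢0)))
        alternatingWord : (∃ λ a → a < q × f 0 ≡ suc a) → Alternating (applyUpTo f n)
        alternatingWord (a , a<q , eq) = a , a<q , alternating-unique a<q f<p eq sums
      ...   | yes (t , t< , sum≢0) = inj₂ result
        where
        f≉0 : ∀ t → t < n → ¬ f t ≋ 0
        f≉0 t lt = nonzero (NoEnd.nonzero-after ¬end f0≢0 t lt)
        0<n : 0 < n
        0<n = s≤s z≤n
        1<n : 1 < n
        1<n = s≤s (s≤s z≤n)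
        2<n : 2 < n
        2<n = s≤s (s≤s (s≤s z≤n))
        via-alternation : suc I ≋ 0 → suc I′ ≋ 0 → I ≋ I′ × J ≋ J′
        via-alternation eq eq′ = suc-cancel-≋ (≋-trans eq (≋-sym eq′)) ,
          columns-at-start (no-alternation rec (s≤s t<) eq (sum≢0 ∘ un))
              (no-alternation rec′ (s≤s t<) eq′ (sum≢0 ∘ un))
        result : I ≋ I′ × J ≋ J′
        result with (f 0 + f 1) % p ℕ.≟ 0 | (f 1 + f 2) % p ℕ.≟ 0
        ... | yes eq | _ = via-alternation (alternation rec 1<n (f≉0 0 0<n) (mk eq))
            (alternation rec′ 1<n (f≉0 0 0<n) (mk eq))
        ... | no _ | yes eq = via-alternation (alternation rec 2<n (f≉0 1 1<n) (mk eq))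
            (alternation rec′ 2<n (f≉0 1 1<n) (mk eq))
        ... | no A≢0 | no B≢0 = rows , cols
          where
          α = (f 0 + f 1) * f 1
          β = (f 1 + f 2) * f 0
          β≉0 : ¬ β ≋ 0
          β≉0 eq with ≋0-* (f 1 + f 2) (f 0) eq
          ... | inj₁ B≋0 = B≢0 (un B≋0)
          ... | inj₂ x≋0 = f≉0 0 0<n x≋0
          -- Both columns satisfy (J+1) α = (J+2) β, so eliminating α gives (J+2)(J′+1) = (J′+2)(J+1).
          crossed : suc (suc J) * suc J′ ≋ suc (suc J′) * suc J
          crossed = *-cancelʳ-≋ β β≉0 (≋-trans (≋-reflexive (swap (suc (suc J)) (suc J′) β))
            (≋-trans (*-≋ (≋-sym (column-ratio rec)) ≋-refl)
            (≋-trans (≋-reflexive (swap′ (suc J) α (suc J′)))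
            (≋-trans (*-≋ (column-ratio rec′) ≋-refl) (≋-reflexive (sym (swap (suc (suc J′)) (suc J) β)))))))
            where
            swap : ∀ x y z → x * y * z ≡ x * z * y
            swap = ℕ-Ring.solve-∀
            swap′ : ∀ x y z → x * y * z ≡ z * y * x
            swap′ = ℕ-Ring.solve-∀
          cols : J ≋ J′
          cols = ≋-sym (+-cancelʳ-≋ J′ J (J * J′ + J + J′ + 2) (subst₂ _≋_ (lemma₁ J J′) (lemma₂ J J′) crossed))
            where
            lemma₁ : ∀ J J′ → suc (suc J) * suc J′ ≡ J′ + (J * J′ + J + J′ + 2)
            lemma₁ = ℕ-Ring.solve-∀
            lemma₂ : ∀ J J′ → suc (suc J′) * suc J ≡ J + (J * J′ + J + J′ + 2)
            lemma₂ = ℕ-Ring.solve-∀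
          rows : I ≋ I′
          rows = suc-cancel-≋ (*-cancelʳ-≋ (f 0) (f≉0 0 0<n) (≋-trans (≋-sym (recurrence rec 1<n))
            (≋-trans (*-≋ (+-≋ (≋-refl {1}) (+-≋ cols (≋-refl {0}))) ≋-refl) (recurrence rec′ 1<n))))

      degenerate-or-determined : Goal
      degenerate-or-determined with end? | start?
      ... | yes end | yes start = both end start
      ... | yes end | no ¬start = end-only end ¬start
      ... | no ¬end | yes start = start-only ¬end start
      ... | no ¬end | no ¬start = neither ¬end ¬start

  module Recurrence (q : ℕ) (prime : Prime (suc q)) (m : ℕ) where
    open Congruence q prime
    open Windows q prime
    open Collisions q prime m

    word : (ℕ → ℕ) → List ℕ
    word f = applyUpTo f n

    word-at : ∀ f g {t} → t < n → word f ≡ word g → f t ≡ g t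
    word-at f g t<n eq = applyUpTo-injective f g n eq t<n

    expansion-scale : ∀ a {k s} i j →
      Expansion n k s (word λ t → (a * G (k + i * p) (suc k + s + j * p + t)) % p)
    expansion-scale a {k} {s} i j with scale a (k + i * p) (suc k + s + j * p) n
    ... | i′ , j′ , eq = expansion (i + i′) (j + j′)
      (trans (sym eq) (cong₂ (λ x y → window x y n) (lemma k i i′ p) (lemma (suc k + s) j j′ p)))
      where
      lemma : ∀ x i i′ p → x + i * p + i′ * p ≡ x + (i + i′) * p
      lemma = ℕ-Ring.solve-∀

    *-one : ∀ a c → c ≋ 1 → a * c ≋ a
    *-one a c eq = ≋-trans (*-≋ (≋-refl {a}) eq) (≋-reflexive (ℕₚ.*-identityʳ a))

    *-zero : ∀ a c → c ≋ 0 → a * c ≋ 0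
    *-zero a c eq = ≋-trans (*-≋ (≋-refl {a}) eq) (≋-reflexive (ℕₚ.*-zeroʳ a))

    expansion-zeros : ∀ k s → Expansion n k s (word zeros)
    expansion-zeros k s = expansion 0 0 (applyUpTo-cong n λ t _ → sym (cong (_% p)
      (k>n⇒nCk≡0 {k + 0} {suc k + s + 0 + t} (s≤s
          (ℕₚ.≤-trans (ℕₚ.+-monoˡ-≤ 0 (ℕₚ.m≤m+n k s)) (ℕₚ.m≤m+n (k + s + 0) t))))))

    expansion-leftmost : ∀ k {a} → a < q → Expansion n k q (word (leftmost (suc a)))
    expansion-leftmost k {a} a<q = subst (Expansion n k q) (applyUpTo-cong n value) (expansion-scale (suc a) 1 0)
      where
      I J : ℕ
      I = k + 1 * p
      J = suc k + q + 0 * p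
      J≡I : J ≡ I
      J≡I = lemma k q
        where
        lemma : ∀ k q → suc k + q + 0 ≡ k + (suc q + 0)
        lemma = ℕ-Ring.solve-∀
      value : ∀ t → t < n → (suc a * G I (J + t)) % p ≡ leftmost (suc a) t
      value zero _ = scaled-entry (suc a) I (J + 0) (s≤s a<q) (*-one (suc a) (I C (J + 0)) (≋-reflexive
        (trans (cong (I C_) (trans (ℕₚ.+-identityʳ J) J≡I)) (nCn≡1 I))))
      value (suc t) _ = scaled-entry (suc a) I (J + suc t) (s≤s z≤n) (*-zero (suc a) (I C (J + suc t)) (≋-reflexive
        (k>n⇒nCk≡0 (subst (_< J + suc t) J≡I (ℕₚ.m<m+n J (s≤s z≤n))))))

    expansion-rightmost : ∀ {k s a} → k < p → n + k + s ≋ 0 → a < q → Expansion n k s (word (rightmost (suc a)))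
    expansion-rightmost {k} {s} {a} k<p eq a<q = subst (Expansion n k s) (applyUpTo-cong n value)
        (expansion-scale (suc a) (p ^ v) j)
      where
      v j I J : ℕ
      v = (n + k + s) / p
      j = p ^ v ∸ v
      I = k + p ^ v * p
      J = suc k + s + j * p
      last-column : J + suc (suc m) ≡ p ^ suc v
      last-column = trans (lemma k s (j * p) m)
          (trans (cong (_+ j * p) (trans (digits (n + k + s)) (cong (_+ v * p) (un eq))))
        (trans (sym (ℕₚ.*-distribʳ-+ p v j)) (trans (cong (_* p) (ℕₚ.m+[n∸m]≡n (ℕₚ.<⇒≤ (n<m^n 1<p v))))
            (ℕₚ.*-comm (p ^ v) p))))
        where
        lemma : ∀ k s x m → suc k + s + x + suc (suc m) ≡ suc (suc (suc m)) + k + s + x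
        lemma = ℕ-Ring.solve-∀
      I≡ : I ≡ p ^ suc v + k
      I≡ = trans (ℕₚ.+-comm k (p ^ v * p)) (cong (_+ k) (ℕₚ.*-comm (p ^ v) p))
      k<P : k < p ^ suc v
      k<P = ℕₚ.<-≤-trans k<p (ℕₚ.m≤m*n p (p ^ v) {{ℕₚ.m^n≢0 p v}})
      value : ∀ t → t < n → (suc a * G I (J + t)) % p ≡ rightmost (suc a) t
      value t t<n with ℕₚ.m≤n⇒m<n∨m≡n t<n
      ... | inj₂ refl = trans (scaled-entry (suc a) I (J + t) (s≤s a<q) (*-one (suc a) (I C (J + t))
          (≋-trans (≋-reflexive (cong₂ _C_ I≡ (trans last-column (sym (ℕₚ.+-identityʳ (p ^ suc v))))))
              (right-copy (suc v) 0 k<P))))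
        (sym (rightmost-last (suc a)))
      ... | inj₁ 1+t<n = trans (scaled-entry (suc a) I (J + t) (s≤s z≤n) (*-zero (suc a) (I C (J + t))
          (≋-trans (≋-reflexive (cong (_C (J + t)) I≡)) (≋-trans (left-copy (suc v) k column<)
            (≋-reflexive (k>n⇒nCk≡0 (ℕₚ.≤-trans (ℕₚ.m≤m+n (suc k) s)
                (ℕₚ.≤-trans (ℕₚ.m≤m+n (suc k + s) (j * p)) (ℕₚ.m≤m+n J t)))))))))
        (sym (rightmost-early (suc a) 1+t<n))
        where
        column< : J + t < p ^ suc v
        column< = subst (J + t <_) last-column (ℕₚ.+-monoʳ-< J (ℕₚ.≤-pred 1+t<n))

    expansion-alternating : ∀ s {a} → a < q → Expansion n q s (word (alternating (suc a)))
    expansion-alternating s {a} a<q = subst (Expansion n q s)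
      (alternating-unique a<q (λ t → DM.m%n<n (z * G I (J + t)) p) first sums) (expansion-scale z i 0)
      where
      N i I J : ℕ
      N = suc q + s + 0 + n
      i = pred (p ^ N)
      I = q + i * p
      J = suc q + s + 0 * p
      suc-I : suc I ≡ p ^ suc N
      suc-I = trans (cong (_* p) (ℕₚ.suc-pred (p ^ N) {{ℕₚ.m^n≢0 p N}})) (ℕₚ.*-comm (p ^ N) p)
      column< : ∀ {t} → t < n → J + t < p ^ suc N
      column< t<n = ℕₚ.<-trans (ℕₚ.+-monoʳ-< J t<n) (ℕₚ.<-trans (ℕₚ.n<1+n N) (n<m^n 1<p (suc N)))
      neighbours : ∀ x → suc x < p ^ suc N → I C x + I C suc x ≋ 0
      neighbours x lt = ≋-trans (≋-reflexive (trans (nCk+nC[k+1]≡[n+1]C[k+1] I x)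
        (cong (_C suc x) (trans suc-I (sym (ℕₚ.+-identityʳ (p ^ suc N))))))) (left-copy (suc N) 0 lt)
      nonzero : ∀ x → x < p ^ suc N → ¬ I C x ≋ 0
      nonzero zero _ = positive≉0 1<p
      nonzero (suc x) lt eq = nonzero x (ℕₚ.<-trans (ℕₚ.n<1+n x) lt)
        (≋-trans (≋-reflexive (sym (ℕₚ.+-identityʳ (I C x))))
            (≋-trans (+-≋ (≋-refl {I C x}) (≋-sym eq)) (neighbours x lt)))
      scalar : ∃ λ z → z < p × (I C (J + 0)) * z ≋ suc a
      scalar = quotient (I C (J + 0)) (suc a) (nonzero (J + 0) (column< (s≤s z≤n)))
      z = proj₁ scalar
      first : (z * G I (J + 0)) % p ≡ suc a
      first = scaled-entry z I (J + 0) (s≤s a<q)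
        (≋-trans (≋-reflexive (ℕₚ.*-comm z (I C (J + 0)))) (proj₂ (proj₂ scalar)))
      sums : ∀ {t} → suc t < n → (z * G I (J + t)) % p + (z * G I (J + suc t)) % p ≋ 0
      sums {t} lt = ≋-trans (+-≋ (%-≋ (z * G I (J + t))) (%-≋ (z * G I (J + suc t))))
        (≋-trans (+-≋ (*-≋ (≋-refl {z}) (%-≋ (I C (J + t)))) (*-≋ (≋-refl {z}) (%-≋ (I C (J + suc t)))))
        (≋-trans (≋-reflexive (trans (sym (ℕₚ.*-distribˡ-+ z (I C (J + t)) (I C (J + suc t))))
            (cong (λ x → z * (I C (J + t) + I C x)) (ℕₚ.+-suc J t))))
        (≋-trans (*-≋ (≋-refl {z}) (neighbours (J + t) (subst (_< p ^ suc N) (ℕₚ.+-suc J t) (column< lt))))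
            (≋-reflexive (ℕₚ.*-zeroʳ z)))))

    expansion-recurrent : ∀ {k s} f → Expansion n k s (word f) → Recurrent k (suc k + s) f
    expansion-recurrent {k} {s} f (expansion i j eq) =
      recurrent-resp (reduce k i) (reduce (suc k + s) j) (recurrent-window {f = f} eq)
      where
      reduce : ∀ x i → x + i * p ≋ x
      reduce x i = mk (DM.[m+kn]%n≡m%n x i p)

    1<n : 1 < n
    1<n = s≤s (s≤s z≤n)

    leftmost-offset : ∀ {k s a} → s < p → a < q → Expansion n k s (word (leftmost (suc a))) → s ≡ q
    leftmost-offset {k} {s} {a} s<p a<q ex = suc-≋0 s<p (+-cancelʳ-≋ (suc s) 0 k (≋-trans (≋-reflexive (lemma k s))
      (row-end (expansion-recurrent (leftmost (suc a)) ex) {0} 1<n (positive≉0 (s≤s a<q)) ≋-refl)))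
      where
      lemma : ∀ k s → suc s + k ≡ suc k + s + 0
      lemma = ℕ-Ring.solve-∀

    rightmost-offset : ∀ {k s a} → a < q → Expansion n k s (word (rightmost (suc a))) → n + k + s ≋ 0
    rightmost-offset {k} {s} {a} a<q ex = ≋-trans (≋-reflexive (lemma k s m))
      (row-start (expansion-recurrent (rightmost (suc a)) ex) {suc m} ℕₚ.≤-refl
          (≋-reflexive (rightmost-early (suc a) (ℕₚ.n<1+n _)))
        (positive≉0 (s≤s a<q) ∘ ≋-trans (≋-reflexive (sym (rightmost-last (suc a))))))
      where
      lemma : ∀ k s m → suc (suc (suc m)) + k + s ≡ suc (suc k + s + suc m)
      lemma = ℕ-Ring.solve-∀

    alternating-row : ∀ {k s a} → k < p → a < q → Expansion n k s (word (alternating (suc a))) → k ≡ q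
    alternating-row {k} {s} {a} k<p a<q ex = suc-≋0 k<p
        (alternation (expansion-recurrent (alternating (suc a)) ex) {0} 1<n (positive≉0 (s≤s a<q))
      (alternating-sum (s≤s (ℕₚ.<⇒≤ a<q)) 0))

    rightOffset : ℕ → ℕ
    rightOffset k = (q * (n + k)) % p

    rightOffset-≋ : ∀ k → n + k + rightOffset k ≋ 0
    rightOffset-≋ k = ≋-trans (+-≋ (≋-refl {n + k}) (%-≋ (q * (n + k)))) (a+q*a (n + k))

    rightOffset-unique : ∀ {k s} → s < p → n + k + s ≋ 0 → s ≡ rightOffset k
    rightOffset-unique {k} {s} s<p eq = ≋⇒≡ s<p (DM.m%n<n (q * (n + k)) p) (+-cancelʳ-≋ s (rightOffset k) (n + k)
      (≋-trans (≋-reflexive (ℕₚ.+-comm s (n + k)))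
          (≋-trans eq (≋-trans (≋-sym (rightOffset-≋ k)) (≋-reflexive (ℕₚ.+-comm (n + k) (rightOffset k)))))))

    Triple : Set
    Triple = ℕ × ℕ × List ℕ

    wordOf : Triple → List ℕ
    wordOf (_ , _ , w) = w

    Expansions : Triple → Set
    Expansions = Indexed p (λ k → Indexed p (Expansion n k))

    below : ℕ → ℕ → ℕ × ℕ → Set
    below a b (x , y) = x < a × y < b

    zeroTriple leftTriple rightTriple alternatingTriple : ℕ × ℕ → Triple
    zeroTriple (k , s) = k , s , word zeros
    leftTriple (k , a) = k , q , word (leftmost (suc a))
    rightTriple (k , a) = k , rightOffset k , word (rightmost (suc a))
    alternatingTriple (s , a) = q , s , word (alternating (suc a))

    ZeroT LeftT RightT AlternatingT DegenerateT : Triple → Set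
    ZeroT y = ∃ λ x → below p p x × y ≡ zeroTriple x
    LeftT y = ∃ λ x → below p q x × y ≡ leftTriple x
    RightT y = ∃ λ x → below p q x × y ≡ rightTriple x
    AlternatingT y = ∃ λ x → below p q x × y ≡ alternatingTriple x
    DegenerateT y = ZeroT y ⊎ LeftT y ⊎ RightT y ⊎ AlternatingT y

    zeroT-word : ∀ {y} → ZeroT y → Zero (wordOf y)
    zeroT-word (_ , _ , refl) = refl

    leftT-word : ∀ {y} → LeftT y → Left (wordOf y)
    leftT-word ((_ , a) , (_ , a<q) , refl) = a , a<q , refl

    rightT-word : ∀ {y} → RightT y → Right (wordOf y)
    rightT-word ((_ , a) , (_ , a<q) , refl) = a , a<q , refl

    alternatingT-word : ∀ {y} → AlternatingT y → Alternating (wordOf y)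
    alternatingT-word ((_ , a) , (_ , a<q) , refl) = a , a<q , refl

    degenerateT-word : ∀ {y} → DegenerateT y → Degenerate (wordOf y)
    degenerateT-word = Sum.map zeroT-word (Sum.map leftT-word (Sum.map rightT-word alternatingT-word))

    degenerateT-expansion : ∀ {y} → DegenerateT y → Expansions y
    degenerateT-expansion (inj₁ ((k , s) , (k<p , s<p) , refl)) = k<p , s<p , expansion-zeros k s
    degenerateT-expansion (inj₂ (inj₁ ((k , a) , (k<p , a<q) , refl))) = k<p , ℕₚ.≤-refl , expansion-leftmost k a<q
    degenerateT-expansion (inj₂ (inj₂ (inj₁ ((k , a) , (k<p , a<q) , refl)))) =
      k<p , DM.m%n<n (q * (n + k)) p , expansion-rightmost k<p (rightOffset-≋ k) a<q
    degenerateT-expansion (inj₂ (inj₂ (inj₂ ((s , a) , (s<p , a<q) , refl)))) =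
      ℕₚ.≤-refl , s<p , expansion-alternating s a<q

    degenerate-expansion : ∀ {y} → Expansions y → Degenerate (wordOf y) → DegenerateT y
    degenerate-expansion {k , s , _} (k<p , s<p , ex) (inj₁ refl) = inj₁ ((k , s) , (k<p , s<p) , refl)
    degenerate-expansion {k , s , _} (k<p , s<p , ex) (inj₂ (inj₁ (a , a<q , refl)))
      with refl ← leftmost-offset s<p a<q ex = inj₂ (inj₁ ((k , a) , (k<p , a<q) , refl))
    degenerate-expansion {k , s , _} (k<p , s<p , ex) (inj₂ (inj₂ (inj₁ (a , a<q , refl)))) =
      inj₂ (inj₂ (inj₁ ((k , a) , (k<p , a<q) , cong (λ x → k , x , _)
          (rightOffset-unique s<p (rightmost-offset a<q ex)))))
    degenerate-expansion {k , s , _} (k<p , s<p , ex) (inj₂ (inj₂ (inj₂ (a , a<q , refl))))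
      with refl ← alternating-row k<p a<q ex = inj₂ (inj₂ (inj₂ ((s , a) , (s<p , a<q) , refl)))

    degenerate-window : ∀ {w} → Degenerate w → Window n w
    degenerate-window d = let (_ , (_ , _ , ex) , eq) = triple d in subst (Window n) eq (expansion⇒window ex)
      where
      triple : ∀ {w} → Degenerate w → ∃ λ y → Expansions y × wordOf y ≡ w
      triple (inj₁ refl) = _ , degenerateT-expansion (inj₁ ((0 , 0) , (s≤s z≤n , s≤s z≤n) , refl)) , refl
      triple (inj₂ (inj₁ (a , a<q , refl))) = _ , degenerateT-expansion
          (inj₂ (inj₁ ((0 , a) , (s≤s z≤n , a<q) , refl))) , refl
      triple (inj₂ (inj₂ (inj₁ (a , a<q , refl)))) = _ , degenerateT-expansion
          (inj₂ (inj₂ (inj₁ ((0 , a) , (s≤s z≤n , a<q) , refl)))) , refl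
      triple (inj₂ (inj₂ (inj₂ (a , a<q , refl)))) = _ , degenerateT-expansion
          (inj₂ (inj₂ (inj₂ ((0 , a) , (s≤s z≤n , a<q) , refl)))) , refl

    last<n : suc (suc m) < n
    last<n = ℕₚ.≤-refl

    0<n : 0 < n
    0<n = s≤s z≤n

    leftmost-injective : ∀ {a b} → word (leftmost (suc a)) ≡ word (leftmost (suc b)) → a ≡ b
    leftmost-injective {a} {b} eq = ℕₚ.suc-injective (word-at (leftmost (suc a)) (leftmost (suc b)) 0<n eq)

    rightmost-injective : ∀ {a b} → word (rightmost (suc a)) ≡ word (rightmost (suc b)) → a ≡ b
    rightmost-injective {a} {b} eq = ℕₚ.suc-injective (trans (sym (rightmost-last (suc a)))
      (trans (word-at (rightmost (suc a)) (rightmost (suc b)) last<n eq) (rightmost-last (suc b))))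

    alternating-injective : ∀ {a b} → word (alternating (suc a)) ≡ word (alternating (suc b)) → a ≡ b
    alternating-injective {a} {b} eq = ℕₚ.suc-injective (word-at (alternating (suc a)) (alternating (suc b)) 0<n eq)

    zero-disjoint : ∀ {w} → Zero w → Left w ⊎ Right w ⊎ Alternating w → ⊥
    zero-disjoint refl (inj₁ (a , _ , eq)) with word-at zeros (leftmost (suc a)) 0<n eq
    ... | ()
    zero-disjoint refl (inj₂ (inj₁ (a , _ , eq)))
      with trans (word-at zeros (rightmost (suc a)) last<n eq) (rightmost-last (suc a))
    ... | ()
    zero-disjoint refl (inj₂ (inj₂ (a , _ , eq))) with word-at zeros (alternating (suc a)) 0<n eq
    ... | ()

    left-disjoint : ∀ {w} → Left w → Right w ⊎ Alternating w → ⊥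
    left-disjoint (a , _ , refl) (inj₁ (b , _ , eq))
      with trans (word-at (leftmost (suc a)) (rightmost (suc b)) 0<n eq) (rightmost-early (suc b) 1<n)
    ... | ()
    left-disjoint (a , _ , refl) (inj₂ (b , b<q , eq)) =
      ℕₚ.m<n⇒n≢0 (ℕₚ.m<n⇒0<n∸m b<q) (sym (word-at (leftmost (suc a)) (alternating (suc b)) 1<n eq))

    right-disjoint : ∀ {w} → Right w → Alternating w → ⊥
    right-disjoint (a , _ , refl) (b , _ , eq)
      with trans (sym (rightmost-early (suc a) 1<n)) (word-at (rightmost (suc a)) (alternating (suc b)) 0<n eq)
    ... | ()

    card-degenerate : Card Degenerate (+ 1 ℤ.+ (+ q ℤ.+ (+ q ℤ.+ + q)))
    card-degenerate = card-⊎ (card-singleton (word zeros))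
      (card-⊎ (card-image (word ∘ leftmost ∘ suc) (λ _ _ → leftmost-injective) (card-< q))
        (card-⊎ (card-image (word ∘ rightmost ∘ suc) (λ _ _ → rightmost-injective) (card-< q))
                (card-image (word ∘ alternating ∘ suc) (λ _ _ → alternating-injective) (card-< q))
          right-disjoint) left-disjoint) zero-disjoint

    card-degenerateT : Card DegenerateT (+ p ℤ.* + p ℤ.+ (+ p ℤ.* + q ℤ.+ (+ p ℤ.* + q ℤ.+ + p ℤ.* + q)))
    card-degenerateT = card-⊎ (card-image zeroTriple (λ _ _ → zero-inj) (card-× (card-< p) (card-< p)))
      (card-⊎ (card-image leftTriple (λ _ _ → left-inj) (card-× (card-< p) (card-< q)))
        (card-⊎ (card-image rightTriple (λ _ _ → right-inj) (card-× (card-< p) (card-< q)))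
                (card-image alternatingTriple (λ _ _ → alternating-inj) (card-× (card-< p) (card-< q)))
          (λ r a → right-disjoint (rightT-word r) (alternatingT-word a)))
        (λ l ra → left-disjoint (leftT-word l) (Sum.map rightT-word alternatingT-word ra)))
      (λ z lra → zero-disjoint (zeroT-word z) (Sum.map leftT-word (Sum.map rightT-word alternatingT-word) lra))
      where
      zero-inj : ∀ {x y} → zeroTriple x ≡ zeroTriple y → x ≡ y
      zero-inj eq = cong (λ (k , s , _) → k , s) eq
      left-inj : ∀ {x y} → leftTriple x ≡ leftTriple y → x ≡ y
      left-inj eq = cong₂ _,_ (cong proj₁ eq) (leftmost-injective (cong wordOf eq))
      right-inj : ∀ {x y} → rightTriple x ≡ rightTriple y → x ≡ y
      right-inj eq = cong₂ _,_ (cong proj₁ eq) (rightmost-injective (cong wordOf eq))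
      alternating-inj : ∀ {x y} → alternatingTriple x ≡ alternatingTriple y → x ≡ y
      alternating-inj eq = cong₂ _,_ (cong (proj₁ ∘ proj₂) eq) (alternating-injective (cong wordOf eq))

    _≟T_ : DecidableEquality Triple
    _≟T_ = ×-≡-dec ℕ._≟_ (×-≡-dec ℕ._≟_ (≡-dec ℕ._≟_))

    card-window-step : (h : ℕ → ℤ) → (∀ {k s} → k < p → s < p → Card (Window (cells n k s)) (h (cells n k s))) →
      Card (Window n) (sumBelow (λ k → sumBelow (λ s → h (cells n k s)) p) p
        ℤ.- (+ p ℤ.* + p ℤ.+ (+ p ℤ.* + q ℤ.+ (+ p ℤ.* + q ℤ.+ + p ℤ.* + q)))
        ℤ.+ (+ 1 ℤ.+ (+ q ℤ.+ (+ q ℤ.+ + q))))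
    card-window-step h smaller = card-resp to from
      (card-⊎ (card-image wordOf injective (card-∖ _≟T_ card-expansions card-degenerateT degenerateT-expansion))
        card-degenerate disjoint)
      where
      card-expansions : Card Expansions (sumBelow (λ k → sumBelow (λ s → h (cells n k s)) p) p)
      card-expansions = card-Σ _ p λ k k<p → card-Σ (λ s → h (cells n k s)) p λ s s<p →
        card-expansion 0<n k<p s<p (smaller k<p s<p)

      Proper : Triple → Set
      Proper y = Expansions y × ¬ DegenerateT y

      injective : ∀ {y y′} → Proper y → Proper y′ → wordOf y ≡ wordOf y′ → y ≡ y′
      injective {k , s , _} {k′ , s′ , _} ((k<p , s<p , ex@(expansion i j refl)) , proper)
          ((k′<p , s′<p , ex′) , _) refl
        with degenerate-or-determined (λ t → G<p (k + i * p) (suc k + s + j * p + t)) (expansion-recurrent _ ex)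
            (expansion-recurrent _ ex′)
      ... | inj₁ degenerate = contradiction (degenerate-expansion (k<p , s<p , ex) degenerate) proper
      ... | inj₂ (k≋ , s≋) with refl ← ≋⇒≡ k<p k′<p k≋
                           with refl ← ≋⇒≡ s<p s′<p (+-cancelʳ-≋ s s′ (suc k)
                             (subst₂ _≋_ (ℕₚ.+-comm (suc k) s) (ℕₚ.+-comm (suc k) s′) s≋)) = refl

      disjoint : ∀ {w} → (∃ λ y → Proper y × w ≡ wordOf y) → Degenerate w → ⊥
      disjoint (y , (ex , proper) , refl) degenerate = proper (degenerate-expansion ex degenerate)

      to : ∀ {w} → (∃ λ y → Proper y × w ≡ wordOf y) ⊎ Degenerate w → Window n w
      to (inj₁ (_ , ((_ , _ , ex) , _) , refl)) = expansion⇒window ex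
      to (inj₂ degenerate) = degenerate-window degenerate

      from : ∀ {w} → Window n w → (∃ λ y → Proper y × w ≡ wordOf y) ⊎ Degenerate w
      from {w} win with window⇒expansion win
      ... | k , s , k<p , s<p , ex with card⇒decidable _≟T_ card-degenerateT (k , s , w)
      ...   | yes degenerate = inj₂ (degenerateT-word degenerate)
      ...   | no proper = inj₁ ((k , s , w) , ((k<p , s<p , ex) , proper) , refl)

-- The count

module Count (q : ℕ) (prime : Prime (suc q)) (2≤q : 2 ≤ q) where
  open Congruence q prime
  open Windows q prime

  q-even : ∃ λ r → q ≡ r ℕ.* 2
  q-even with q % 2 | DM.m%n<n q 2 | DM.m≡m%n+[m/n]*n q 2
  ... | zero | _ | eq = q / 2 , eq
  ... | suc zero | _ | eq with prime⇒irreducible prime (Div.divides (suc (q / 2)) (cong suc eq))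
  ...   | inj₁ ()
  ...   | inj₂ 2≡p = contradiction (ℕₚ.suc-injective 2≡p) (ℕₚ.<⇒≢ 2≤q)
  q-even | suc (suc _) | s≤s (s≤s ()) | _

  half-square : + 2 ℤ.* + ((q ℕ.* q) / 2) ≡ (+ p ℤ.- + 1) ℤ.* (+ p ℤ.- + 1)
  half-square = trans (sym (ℤₚ.pos-* 2 (q ℕ.* q / 2))) (trans (cong +_ (trans (ℕₚ.*-comm 2 (q ℕ.* q / 2))
    (DM.m/n*n≡m (Div.∣n⇒∣m*n q (Div.divides (proj₁ q-even) (proj₂ q-even)))))) (ℤₚ.pos-* q q))

  open Series q 2≤q half-square using (h; h-0; h-1; h-2; rhs-recurrence; overcount; degenerates; doubleSum)

  scaled-window : ∀ a i j n → Window n (applyUpTo (λ t → (a ℕ.* G i (j ℕ.+ t)) % p) n)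
  scaled-window a i j n = let (i′ , j′ , eq) = scale a i j n in i ℕ.+ i′ ℕ.* p , j ℕ.+ j′ ℕ.* p , sym eq

  window-1 : ∀ {a} → a < p → Window 1 (a ∷ [])
  window-1 {a} a<p = subst (Window 1) (cong (_∷ []) (scaled-entry a 0 0 a<p (≋-reflexive (ℕₚ.*-identityʳ a))))
    (scaled-window a 0 0 1)

  window-2 : ∀ {a b} → a < p → b < p → Window 2 (a ∷ b ∷ [])
  window-2 {zero} {b} a<p b<p = subst (Window 2) (cong₂ (λ x y → x ∷ y ∷ [])
      (scaled-entry b p (q ℕ.+ 0) a<p (≋-trans (*-≋ (≋-refl {b}) pCq≋0) (≋-reflexive (ℕₚ.*-zeroʳ b))))
      (scaled-entry b p (q ℕ.+ 1) b<p (≋-reflexive (trans (cong (λ x → b ℕ.* (p C x)) (ℕₚ.+-comm q 1))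
        (trans (cong (b ℕ.*_) (nCn≡1 p)) (ℕₚ.*-identityʳ b))))))
    (scaled-window b p q 2)
    where
    1+pred : suc (ℕ.pred q) ≡ q
    1+pred = ℕₚ.suc-pred q {{ℕ.>-nonZero (ℕₚ.≤-trans (s≤s z≤n) 2≤q)}}
    pCq≋0 : p C (q ℕ.+ 0) ≋ 0
    pCq≋0 = subst (λ x → p C x ≋ 0) (trans 1+pred (sym (ℕₚ.+-identityʳ q)))
      (pCl≋0 (subst (_< p) (sym 1+pred) ℕₚ.≤-refl))
  window-2 {suc a} {b} a<p b<p = let (k , _ , eq) = quotient (suc a) b (positive≉0 a<p) in
    subst (Window 2) (cong₂ (λ x y → x ∷ y ∷ [])
      (scaled-entry (suc a) k 0 a<p (≋-reflexive (ℕₚ.*-identityʳ (suc a))))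
      (scaled-entry (suc a) k 1 b<p (≋-trans (≋-reflexive (cong (suc a ℕ.*_) (nC1≡n k))) eq)))
    (scaled-window (suc a) k 0 2)

  card-window-0 : Card (Window 0) (+ 1)
  card-window-0 = card-resp (λ { refl → 0 , 0 , refl }) (λ { (_ , _ , refl) → refl }) (card-singleton [])

  card-window-1 : Card (Window 1) (+ p)
  card-window-1 = card-resp (λ { (_ , a<p , refl) → window-1 a<p })
    (λ { (i , j , refl) → _ , G<p i (j ℕ.+ 0) , refl }) (card-image (_∷ []) (λ { _ _ refl → refl }) (card-< p))

  card-window-2 : Card (Window 2) (+ p ℤ.* + p)
  card-window-2 = card-resp (λ { (_ , (a<p , b<p) , refl) → window-2 a<p b<p })
    (λ { (i , j , refl) → _ , (G<p i (j ℕ.+ 0) , G<p i (j ℕ.+ 1)) , refl })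
    (card-image (λ (a , b) → a ∷ b ∷ []) (λ { _ _ refl → refl }) (card-× (card-< p) (card-< p)))

  cells-< : ∀ m {k s} → k < p → s < p → cells (suc (suc (suc m))) k s < suc (suc (suc m))
  cells-< m {k} {s} (s≤s k≤q) (s≤s s≤q) = DM.m<n*o⇒m/o<n (begin-strict
    n ℕ.+ k ℕ.+ s          ≡⟨ ℕₚ.+-assoc n k s ⟩
    n ℕ.+ (k ℕ.+ s)        ≤⟨ ℕₚ.+-monoʳ-≤ n (ℕₚ.+-mono-≤ k≤q s≤q) ⟩
    n ℕ.+ (q ℕ.+ q)        <⟨ ℕₚ.+-monoʳ-< n (ℕₚ.+-monoʳ-< q (ℕₚ.m<m+n q (ℕₚ.≤-trans 0<q (ℕₚ.m≤m+n q (m ℕ.* q))))) ⟩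
    n ℕ.+ n ℕ.* q          ≡⟨ sym (ℕₚ.*-suc n q) ⟩
    n ℕ.* p                ∎)
    where
    open ℕₚ.≤-Reasoning
    n = suc (suc (suc m))
    0<q : 0 < q
    0<q = ℕₚ.≤-trans (s≤s z≤n) 2≤q

  card-window : ∀ n → Card (Window n) (h n)
  card-window = <-rec (λ n → Card (Window n) (h n)) step
    where
    step : ∀ n → (∀ {m} → m < n → Card (Window m) (h m)) → Card (Window n) (h n)
    step zero _ = card-≡ (sym h-0) card-window-0
    step (suc zero) _ = card-≡ (sym h-1) card-window-1
    step (suc (suc zero)) _ = card-≡ (sym h-2) card-window-2
    step n@(suc (suc (suc m))) smaller = card-≡
      (trans (cong₂ (λ x y → doubleSum n ℤ.- x ℤ.+ y) (lemma₁ (+ p) (+ q)) (lemma₂ (+ q)))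
          (rhs-recurrence (s≤s (s≤s (s≤s z≤n)))))
      (Recurrence.card-window-step q prime m h (λ k<p s<p → smaller (cells-< m k<p s<p)))
      where
      lemma₁ : ∀ x y → x ℤ.* x ℤ.+ (x ℤ.* y ℤ.+ (x ℤ.* y ℤ.+ x ℤ.* y)) ≡ x ℤ.* x ℤ.+ + 3 ℤ.* (x ℤ.* y)
      lemma₁ = ℤ-Ring.solve-∀
      lemma₂ : ∀ y → + 1 ℤ.+ (y ℤ.+ (y ℤ.+ y)) ≡ + 1 ℤ.+ + 3 ℤ.* y
      lemma₂ = ℤ-Ring.solve-∀

theorem2p7 : (p : ℕ) .{{_ : NonZero p}} → Prime p → 3 ≤ p →
    (n : ℕ) → Σ ℕ (λ N → NumAccessible p onePlusX n N × (+ N ≡ rhs p n))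
theorem2p7 (suc q) p-prime (s≤s 2≤q) n = length elements ,
  (elements , unique , refl ,
    λ b → (λ b∈ → window⇒accessible (sound b∈)) , (λ accessible → complete (accessible⇒window accessible))) ,
  count
  where
  open Windows q p-prime
  open Card (Count.card-window q p-prime 2≤q n)
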